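{- For integers $k\geq 2$ and $m\geq 1$ let $$f(k,m) = m + b_{k,2}\binom{m}{2} + b_{k,3}\binom{m}{3} + \cdots + b_{k,k}\binom{m}{k},$$ where for $2\le \ell\le k$, $$b_{k,\ell} = \frac{\ell-1}{\ell}\sum_{i=0}^{\ell-1}(-1)^{i}\binom{\ell}{i}\binom{k(\ell-i)}{k}.$$ Let $\mathcal{H}=(V,\mathcal{E})$ be a $k$-uniform hypergraph with $|V|=km$ vertices which has a unique perfect matching. Then $|\mathcal{E}|\le f(k,m)$. Moreover, this bound is tight: for all integers $k\ge 2$ and $m\ge 1$ there exists a $k$-uniform hypergraph on $km$ vertices with a unique perfect matching and exactly $f(k,m)$ edges.
   Context: A $k$-uniform hypergraph $\mathcal{H}=(V,\mathcal{E})$ has edge set $\mathcal{E}\subseteq\binom{V}{k}$. A perfect matching in $\mathcal{H}$ (with $|V|=km$) is a collection of $m$ pairwise disjoint edges whose union is $V$. -}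

module Defs where

open import Data.Nat using (ℕ; zero; suc; _*_; _∸_)
open import Data.Nat.Combinatorics using (_C_)
open import Data.Integer as ℤ using (ℤ; +_)
open import Data.Rational as ℚ using (ℚ; _/_)
open import Data.Fin using (Fin)
open import Data.Fin.Subset using (Subset; _∈_; ∣_∣)
open import Data.List using (List; length)
open import Data.List.Relation.Unary.All using (All)
open import Data.List.Relation.Unary.Any using (Any)
open import Data.List.Relation.Unary.AllPairs using (AllPairs)
open import Data.List.Relation.Unary.Unique.Propositional using (Unique)
import Data.List.Membership.Propositional as L
open import Data.Product using (Σ; _×_)
open import Data.Empty using (⊥)
open import Relation.Binary.PropositionalEquality using (_≡_)
open import Function.Bundles using (_⇔_)

sumℤ : ℕ → (ℕ → ℤ) → ℤ
sumℤ zero    g = + 0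
sumℤ (suc n) g = sumℤ n g ℤ.+ g n

sumℚ : ℕ → (ℕ → ℚ) → ℚ
sumℚ zero    g = ℚ.0ℚ
sumℚ (suc n) g = sumℚ n g ℚ.+ g n

innerSum : ℕ → ℕ → ℤ
innerSum k ℓ = sumℤ ℓ (λ i → (ℤ.- ℤ.1ℤ) ℤ.^ i ℤ.* + ((ℓ C i) * ((k * (ℓ ∸ i)) C k)))

-- b_{k,ℓ} = (ℓ-1)/ℓ · innerSum k ℓ   (only used for ℓ ≥ 2)
b : ℕ → ℕ → ℚ
b k zero    = ℚ.0ℚ
b k (suc l) = ((+ l) ℤ.* innerSum k (suc l)) / suc l

f : ℕ → ℕ → ℚ
f k m = (+ m / 1) ℚ.+ sumℚ (k ∸ 1) (λ j → b k (suc (suc j)) ℚ.* ((+ (m C suc (suc j))) / 1))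

record Hypergraph (k n : ℕ) : Set where
  field
    edges   : List (Subset n)
    distinct : Unique edges
    uniform : All (λ e → ∣ e ∣ ≡ k) edges
open Hypergraph public

Disjoint : ∀ {n} → Subset n → Subset n → Set
Disjoint e e' = ∀ v → v ∈ e → v ∈ e' → ⊥

record IsPerfectMatching {k n} (H : Hypergraph k n) (M : List (Subset n)) : Set where
  field
    sub     : All (λ e → e L.∈ edges H) M
    noRep   : Unique M
    disj    : AllPairs Disjoint M
    covers  : ∀ (v : Fin n) → Any (λ e → v ∈ e) M

-- H has exactly one perfect matching (matchings compared as sets of edges).
HasUniquePerfectMatching : ∀ {k n} → Hypergraph k n → Set
HasUniquePerfectMatching {n = n} H =
  Σ (List (Subset n)) λ M → IsPerfectMatching H M ×
    (∀ M' → IsPerfectMatching H M' → ∀ e → (e L.∈ M') ⇔ (e L.∈ M))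

numEdges : ∀ {k n} → Hypergraph k n → ℕ
numEdges H = length (edges H)

{-# OPTIONS --safe #-}
module Submission where

open import Defs
open import Data.Bool using (Bool; true; false; not; _∧_; _∨_; if_then_else_)
import Data.Bool.Properties as Bool
open import Data.Nat hiding (_/_)
open import Data.Nat.Properties
open import Algebra.Properties.CommutativeSemigroup +-commutativeSemigroup using (x∙yz≈y∙xz)
open import Data.Nat.Combinatorics using (_C_; nCk+nC[k+1]≡[n+1]C[k+1]; nCn≡1; nC1≡n; k>n⇒nCk≡0)
open import Data.Nat.Coprimality using (1-coprimeTo) renaming (sym to coprime-sym)
open import Data.Nat.Tactic.RingSolver using (solve-∀)
open import Data.Fin using (Fin; zero; suc; toℕ; inject₁; combine; remQuot)
import Data.Fin as Fin
import Data.Fin.Properties as Fin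
open import Data.Fin.Permutation using (↔⇒≡)
open import Data.Fin.Subset using (Subset; ∣_∣) renaming (_∈_ to _∈ₛ_)
open import Data.Fin.Subset.Properties using (∣p∣≡n⇒p≡⊤; ∣p∣≤n)
open import Data.List using (List; []; _∷_; _++_; length; concatMap; cartesianProductWith; filter; upTo; applyUpTo; allFin)
import Data.List as List
import Data.List.Properties as List
import Data.List.Membership.DecPropositional as DecMembership
open import Data.List.Membership.Propositional using (_∈_; find)
open import Data.List.Membership.Propositional.Properties
open import Data.List.Relation.Unary.All using ([]; _∷_)
import Data.List.Relation.Unary.All as All
import Data.List.Relation.Unary.All.Properties as All
open import Data.List.Relation.Unary.AllPairs using (AllPairs; []; _∷_)
import Data.List.Relation.Unary.AllPairs.Properties as AllPairs
open import Data.List.Relation.Unary.Any using (here; there)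
import Data.List.Relation.Unary.Any as Any
import Data.List.Relation.Unary.Any.Properties as Any
open import Data.List.Relation.Unary.Unique.Propositional using (Unique)
import Data.List.Relation.Unary.Unique.Propositional.Properties as Unique
open import Data.Product using (Σ; _×_; _,_; ∃-syntax; proj₁; proj₂)
open import Data.Sum using (_⊎_; inj₁; inj₂)
open import Data.Vec using (Vec; []; _∷_; map; replicate; lookup; tabulate; sum; _∷ʳ_; head)
import Data.Vec as Vec
import Data.Vec.Properties as Vec
open import Data.Vec.Relation.Unary.All using ([]; _∷_)
import Data.Vec.Relation.Unary.All as VecAll
import Data.Vec.Relation.Unary.All.Properties as VecAll
open import Function using (_∘_; id)
open import Function.Bundles using (mk⇔; mk↔ₛ′; Equivalence)
open import Relation.Nullary using (Dec; does; yes; no; contradiction; ¬_)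
open import Relation.Nullary.Decidable using (dec-false; dec-true; ¬?)
open import Relation.Binary.PropositionalEquality using (_≡_; _≢_; refl; sym; trans; cong; cong₂; subst; subst₂; module ≡-Reasoning)

-- Arrange the vertices as an m × k matrix whose rows are the edges of the matching, so that k-sets
-- become 0/1-matrices of size k, and sort them by their support, the set of rows that they meet.
-- A frame on ℓ ≥ 2 rows is a partition of these rows into ℓ such matrices, each meeting every row;
-- exchanging the rows of the matching for a frame gives a second perfect matching, so each frame
-- contains a non-edge. The row sizes of the members of a frame can be taken to be the cyclic
-- rotations of any prescribed vector a of row sizes, and permuting the entries inside each row
-- averages over all matrices with these row sizes. Hence at least 1/ℓ of the matrices with a given
-- support of size ℓ are non-edges. Equality holds for the hypergraph that omits exactly the
-- k-sets with at least two rows which contain the head of their first row: each frame has exactly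
-- one member of this kind.

-- The obstacle is that the members of a frame have different row sizes, so one frame says nothing
-- about a single type of matrix. The array with rows `rots i a` is a circulant, hence symmetric:
-- read by rows it prescribes how often each colour occurs in row i of the frame, read by columns it
-- gives the row sizes of each colour class. All its lines have the same sum k, so both the rows of
-- the grid and the classes have exactly k cells. Summing over all vectors a makes the rotations
-- indistinguishable, and this turns one non-edge per frame into the fraction 1/ℓ. Subtraction and
-- division are avoided: for each support the edges are compared with those of the extremal family.
-- The same averaging argument is run once with an inequality, for the non-edges of a given
-- hypergraph, and once with an equality, for the sets omitted in the extremal one. The formula `f`
-- enters only at the end: its alternating sum counts the k-sets meeting each of ℓ given rows, and
-- (ℓ-1)/ℓ is the share of them that is not omitted.

⟦_⟧ : Bool → ℕ
⟦ true ⟧ = 1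
⟦ false ⟧ = 0

-- Finite sums over lists and over products of lists

∑ : {X : Set} → List X → (X → ℕ) → ℕ
∑ []       h = 0
∑ (x ∷ xs) h = h x + ∑ xs h

syntax ∑ xs (λ x → e) = ∑[ x ← xs ] e

module _ {X : Set} where

  ∑-cong-∈ : ∀ (xs : List X) {g h : X → ℕ} → (∀ {x} → x ∈ xs → g x ≡ h x) → ∑ xs g ≡ ∑ xs h
  ∑-cong-∈ []       eq = refl
  ∑-cong-∈ (x ∷ xs) eq = cong₂ _+_ (eq (here refl)) (∑-cong-∈ xs (eq ∘ there))

  ∑-cong : ∀ (xs : List X) {g h : X → ℕ} → (∀ x → g x ≡ h x) → ∑ xs g ≡ ∑ xs h
  ∑-cong xs eq = ∑-cong-∈ xs (λ {x} _ → eq x)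

  ∑-mono : ∀ (xs : List X) {g h : X → ℕ} → (∀ x → g x ≤ h x) → ∑ xs g ≤ ∑ xs h
  ∑-mono []       le = z≤n
  ∑-mono (x ∷ xs) le = +-mono-≤ (le x) (∑-mono xs le)

  ∑-mono-∈ : ∀ (xs : List X) {g h : X → ℕ} → (∀ {x} → x ∈ xs → g x ≤ h x) → ∑ xs g ≤ ∑ xs h
  ∑-mono-∈ []       le = z≤n
  ∑-mono-∈ (x ∷ xs) le = +-mono-≤ (le (here refl)) (∑-mono-∈ xs (le ∘ there))

  ∑-0 : ∀ (xs : List X) → ∑[ _ ← xs ] 0 ≡ 0
  ∑-0 []       = refl
  ∑-0 (x ∷ xs) = ∑-0 xs

  ∑-+ : ∀ (xs : List X) (g h : X → ℕ) → ∑[ x ← xs ] (g x + h x) ≡ ∑ xs g + ∑ xs h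
  ∑-+ []       g h = refl
  ∑-+ (x ∷ xs) g h rewrite ∑-+ xs g h = shuffle (g x) (h x) (∑ xs g) (∑ xs h)
    where
    shuffle : ∀ a b c d → a + b + (c + d) ≡ a + c + (b + d)
    shuffle = solve-∀

  ∑-*ˡ : ∀ c (xs : List X) (h : X → ℕ) → ∑[ x ← xs ] (c * h x) ≡ c * ∑ xs h
  ∑-*ˡ c []       h = sym (*-zeroʳ c)
  ∑-*ˡ c (x ∷ xs) h rewrite ∑-*ˡ c xs h = sym (*-distribˡ-+ c (h x) (∑ xs h))

  ∑-++ : ∀ (xs ys : List X) h → ∑ (xs ++ ys) h ≡ ∑ xs h + ∑ ys h
  ∑-++ []       ys h = refl
  ∑-++ (x ∷ xs) ys h rewrite ∑-++ xs ys h = sym (+-assoc (h x) _ _)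

module _ {X Y : Set} where

  ∑-swap : ∀ (xs : List X) (ys : List Y) (h : X → Y → ℕ) →
           ∑[ x ← xs ] ∑[ y ← ys ] h x y ≡ ∑[ y ← ys ] ∑[ x ← xs ] h x y
  ∑-swap []       ys h = sym (∑-0 ys)
  ∑-swap (x ∷ xs) ys h rewrite ∑-swap xs ys h = sym (∑-+ ys (h x) _)

  ∑-map : ∀ (f : X → Y) xs h → ∑ (List.map f xs) h ≡ ∑ xs (h ∘ f)
  ∑-map f []       h = refl
  ∑-map f (x ∷ xs) h = cong (h (f x) +_) (∑-map f xs h)

  ∑-concatMap : ∀ (f : X → List Y) xs h → ∑ (concatMap f xs) h ≡ ∑[ x ← xs ] ∑ (f x) h
  ∑-concatMap f []       h = refl
  ∑-concatMap f (x ∷ xs) h rewrite ∑-++ (f x) (concatMap f xs) h =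
    cong (∑ (f x) h +_) (∑-concatMap f xs h)

∑-cartesian : ∀ {X Y Z : Set} (f : X → Y → Z) xs ys h →
              ∑ (cartesianProductWith f xs ys) h ≡ ∑[ x ← xs ] ∑[ y ← ys ] h (f x y)
∑-cartesian f []       ys h = refl
∑-cartesian f (x ∷ xs) ys h rewrite ∑-++ (List.map (f x) ys) (cartesianProductWith f xs ys) h =
  cong₂ _+_ (∑-map (f x) ys h) (∑-cartesian f xs ys h)

∏ : ∀ {X : Set} {n} → Vec (List X) n → List (Vec X n)
∏ []       = [] ∷ []
∏ (L ∷ Ls) = cartesianProductWith _∷_ L (∏ Ls)

∑-∏ : ∀ {X : Set} {n} (L : List X) (Ls : Vec (List X) n) h →
      ∑ (∏ (L ∷ Ls)) h ≡ ∑[ x ← L ] ∑[ v ← ∏ Ls ] h (x ∷ v)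
∑-∏ L Ls h = ∑-cartesian _∷_ L (∏ Ls) h

infix 8 _^ᴸ_
_^ᴸ_ : ∀ {X : Set} → List X → ∀ n → List (Vec X n)
L ^ᴸ n = ∏ (replicate n L)

∑-^ᴸ : ∀ {X : Set} n (L : List X) h →
       ∑ (L ^ᴸ suc n) h ≡ ∑[ x ← L ] ∑[ v ← L ^ᴸ n ] h (x ∷ v)
∑-^ᴸ n L h = ∑-∏ L (replicate n L) h

product : ∀ {n} → Vec ℕ n → ℕ
product = Vec.foldr _ _*_ 1

-- Lists are read as multisets: if `f` carries each factor `Ls i` to `c i` copies of `Ms i`, then it
-- carries the product to as many copies as the product of the `c i`. Testing against all `h`
-- replaces a notion of equality of multisets.
∑-∏-scale : ∀ {X Y : Set} {n} (f : X → Y) (Ls : Vec (List X) n) (Ms : Vec (List Y) n) (c : Vec ℕ n) →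
            (∀ i h → ∑ (lookup Ls i) (h ∘ f) ≡ lookup c i * ∑ (lookup Ms i) h) →
            ∀ h → ∑ (∏ Ls) (h ∘ map f) ≡ product c * ∑ (∏ Ms) h
∑-∏-scale f [] [] [] eq h = sym (*-identityˡ (h [] + 0))
∑-∏-scale f (L ∷ Ls) (M ∷ Ms) (c ∷ cs) eq h = begin
  ∑ (∏ (L ∷ Ls)) (h ∘ map f)                         ≡⟨ ∑-∏ L Ls _ ⟩
  ∑[ x ← L ] ∑[ v ← ∏ Ls ] h (f x ∷ map f v)         ≡⟨ ∑-cong L (λ x → ∑-∏-scale f Ls Ms cs (eq ∘ suc) (h ∘ (f x ∷_))) ⟩
  ∑[ x ← L ] (product cs * ∑[ v ← ∏ Ms ] h (f x ∷ v)) ≡⟨ ∑-*ˡ (product cs) L _ ⟩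
  product cs * ∑[ x ← L ] ∑[ v ← ∏ Ms ] h (f x ∷ v)  ≡⟨ cong (product cs *_) (eq zero (λ y → ∑[ v ← ∏ Ms ] h (y ∷ v))) ⟩
  product cs * (c * ∑[ y ← M ] ∑[ v ← ∏ Ms ] h (y ∷ v)) ≡⟨ cong (λ s → product cs * (c * s)) (∑-∏ M Ms h) ⟨
  product cs * (c * ∑ (∏ (M ∷ Ms)) h)                ≡⟨ arith (product cs) c _ ⟩
  c * product cs * ∑ (∏ (M ∷ Ms)) h                  ∎
  where
  open ≡-Reasoning
  arith : ∀ a b s → a * (b * s) ≡ b * a * s
  arith = solve-∀

-- Rearranging vectors

module _ {X : Set} where

  insertions : ∀ {n} → X → Vec X n → List (Vec X (suc n))
  insertions x []      = (x ∷ []) ∷ []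
  insertions x (y ∷ v) = (x ∷ y ∷ v) ∷ List.map (y ∷_) (insertions x v)

  -- Equal entries are permuted as if they were distinct, so there are always n! rearrangements,
  -- with repetitions. This is the uniform distribution needed for averaging, and it is compatible
  -- with `map`.
  perms : ∀ {n} → Vec X n → List (Vec X n)
  perms []      = [] ∷ []
  perms (x ∷ v) = concatMap (insertions x) (perms v)

∑-insertions-map : ∀ {X Y : Set} {n} (f : X → Y) x (v : Vec X n) h →
                   ∑ (insertions x v) (h ∘ map f) ≡ ∑ (insertions (f x) (map f v)) h
∑-insertions-map f x []      h = refl
∑-insertions-map f x (y ∷ v) h = cong (h (f x ∷ f y ∷ map f v) +_) (begin
  ∑ (List.map (y ∷_) (insertions x v)) (h ∘ map f)        ≡⟨ ∑-map (y ∷_) (insertions x v) _ ⟩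
  ∑ (insertions x v) (h ∘ (f y ∷_) ∘ map f)               ≡⟨ ∑-insertions-map f x v (h ∘ (f y ∷_)) ⟩
  ∑ (insertions (f x) (map f v)) (h ∘ (f y ∷_))           ≡⟨ ∑-map (f y ∷_) (insertions (f x) (map f v)) h ⟨
  ∑ (List.map (f y ∷_) (insertions (f x) (map f v))) h    ∎)
  where open ≡-Reasoning

∑-perms-map : ∀ {X Y : Set} {n} (f : X → Y) (v : Vec X n) h →
              ∑ (perms v) (h ∘ map f) ≡ ∑ (perms (map f v)) h
∑-perms-map f []      h = refl
∑-perms-map f (x ∷ v) h = begin
  ∑ (concatMap (insertions x) (perms v)) (h ∘ map f)              ≡⟨ ∑-concatMap _ (perms v) _ ⟩
  ∑[ w ← perms v ] ∑ (insertions x w) (h ∘ map f)                 ≡⟨ ∑-cong (perms v) (λ w → ∑-insertions-map f x w h) ⟩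
  ∑[ w ← perms v ] ∑ (insertions (f x) (map f w)) h               ≡⟨ ∑-perms-map f v (λ u → ∑ (insertions (f x) u) h) ⟩
  ∑[ u ← perms (map f v) ] ∑ (insertions (f x) u) h               ≡⟨ ∑-concatMap _ (perms (map f v)) h ⟨
  ∑ (concatMap (insertions (f x)) (perms (map f v))) h            ∎
  where open ≡-Reasoning

subsetsOf : ∀ n → ℕ → List (Vec Bool n)
subsetsOf zero    zero    = [] ∷ []
subsetsOf zero    (suc t) = []
subsetsOf (suc n) zero    = List.map (false ∷_) (subsetsOf n zero)
subsetsOf (suc n) (suc t) = List.map (true ∷_) (subsetsOf n t) ++ List.map (false ∷_) (subsetsOf n (suc t))

∑-subsetsOf-zero : ∀ n h → ∑ (subsetsOf (suc n) 0) h ≡ ∑ (subsetsOf n 0) (h ∘ (false ∷_))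
∑-subsetsOf-zero n h = ∑-map (false ∷_) (subsetsOf n 0) h

∑-subsetsOf-suc : ∀ n t h → ∑ (subsetsOf (suc n) (suc t)) h
                  ≡ ∑ (subsetsOf n t) (h ∘ (true ∷_)) + ∑ (subsetsOf n (suc t)) (h ∘ (false ∷_))
∑-subsetsOf-suc n t h = trans (∑-++ (List.map (true ∷_) (subsetsOf n t)) _ h)
  (cong₂ _+_ (∑-map (true ∷_) (subsetsOf n t) h) (∑-map (false ∷_) (subsetsOf n (suc t)) h))

subsetsOf-empty : ∀ n t → n < t → subsetsOf n t ≡ []
subsetsOf-empty zero    (suc t) _         = refl
subsetsOf-empty (suc n) (suc t) (s≤s n<t)
  rewrite subsetsOf-empty n t n<t | subsetsOf-empty n (suc t) (m<n⇒m<1+n n<t) = refl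

∑-insertions-∷ : ∀ {n} x (y : Bool) (v : Vec Bool n) h →
  ∑ (insertions x (y ∷ v)) h ≡ h (x ∷ y ∷ v) + ∑ (insertions x v) (h ∘ (y ∷_))
∑-insertions-∷ x y v h = cong (h (x ∷ y ∷ v) +_) (∑-map (y ∷_) (insertions x v) h)

-- A set with `suc t` elements arises once for each of its ones, by reinserting that one after its
-- deletion.
∑-insertions-true : ∀ n t h →
  ∑[ A ← subsetsOf n t ] ∑ (insertions true A) h ≡ suc t * ∑ (subsetsOf (suc n) (suc t)) h
∑-insertions-true zero zero    h = arith (h (true ∷ []))
  where
  arith : ∀ a → a + 0 + 0 ≡ 1 * (a + 0)
  arith = solve-∀
∑-insertions-true zero (suc t) h = sym (*-zeroʳ (suc (suc t)))
∑-insertions-true (suc n) zero h = begin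
  ∑[ A ← subsetsOf (suc n) 0 ] ∑ (insertions true A) h
    ≡⟨ ∑-subsetsOf-zero n _ ⟩
  ∑[ A ← subsetsOf n 0 ] ∑ (insertions true (false ∷ A)) h
    ≡⟨ trans (∑-cong (subsetsOf n 0) (λ A → ∑-insertions-∷ true false A h)) (∑-+ (subsetsOf n 0) _ _) ⟩
  ∑[ A ← subsetsOf n 0 ] h (true ∷ false ∷ A) + ∑[ A ← subsetsOf n 0 ] ∑ (insertions true A) (h ∘ (false ∷_))
    ≡⟨ cong₂ _+_ (sym (∑-subsetsOf-zero n (h ∘ (true ∷_)))) (∑-insertions-true n 0 (h ∘ (false ∷_))) ⟩
  ∑ (subsetsOf (suc n) 0) (h ∘ (true ∷_)) + 1 * ∑ (subsetsOf (suc n) 1) (h ∘ (false ∷_))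
    ≡⟨ arith (∑ (subsetsOf (suc n) 0) (h ∘ (true ∷_))) (∑ (subsetsOf (suc n) 1) (h ∘ (false ∷_))) ⟩
  1 * (∑ (subsetsOf (suc n) 0) (h ∘ (true ∷_)) + ∑ (subsetsOf (suc n) 1) (h ∘ (false ∷_)))
    ≡⟨ cong (1 *_) (∑-subsetsOf-suc (suc n) 0 h) ⟨
  1 * ∑ (subsetsOf (suc (suc n)) 1) h ∎
  where
  open ≡-Reasoning
  arith : ∀ a b → a + 1 * b ≡ 1 * (a + b)
  arith = solve-∀
∑-insertions-true (suc n) (suc t) h = begin
  ∑[ A ← subsetsOf (suc n) (suc t) ] ∑ (insertions true A) h
    ≡⟨ ∑-subsetsOf-suc n t _ ⟩
  ∑[ A ← subsetsOf n t ] ∑ (insertions true (true ∷ A)) h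
  + ∑[ A ← subsetsOf n (suc t) ] ∑ (insertions true (false ∷ A)) h
    ≡⟨ cong₂ _+_ (trans (∑-cong (subsetsOf n t) (λ A → ∑-insertions-∷ true true A h)) (∑-+ (subsetsOf n t) _ _))
                 (trans (∑-cong (subsetsOf n (suc t)) (λ A → ∑-insertions-∷ true false A h)) (∑-+ (subsetsOf n (suc t)) _ _)) ⟩
  (∑[ A ← subsetsOf n t ] h (true ∷ true ∷ A) + ∑[ A ← subsetsOf n t ] ∑ (insertions true A) (h ∘ (true ∷_)))
  + (∑[ A ← subsetsOf n (suc t) ] h (true ∷ false ∷ A) + ∑[ A ← subsetsOf n (suc t) ] ∑ (insertions true A) (h ∘ (false ∷_)))
    ≡⟨ cong₂ (λ a b → (∑[ A ← subsetsOf n t ] h (true ∷ true ∷ A) + a) + (∑[ A ← subsetsOf n (suc t) ] h (true ∷ false ∷ A) + b))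
             (∑-insertions-true n t (h ∘ (true ∷_))) (∑-insertions-true n (suc t) (h ∘ (false ∷_))) ⟩
  (∑[ A ← subsetsOf n t ] h (true ∷ true ∷ A) + suc t * S₁)
  + (∑[ A ← subsetsOf n (suc t) ] h (true ∷ false ∷ A) + suc (suc t) * S₀)
    ≡⟨ arith (∑[ A ← subsetsOf n t ] h (true ∷ true ∷ A)) (∑[ A ← subsetsOf n (suc t) ] h (true ∷ false ∷ A)) S₁ S₀ (suc t) ⟩
  (∑[ A ← subsetsOf n t ] h (true ∷ true ∷ A) + ∑[ A ← subsetsOf n (suc t) ] h (true ∷ false ∷ A)) + (suc t * S₁ + suc (suc t) * S₀)
    ≡⟨ cong (_+ (suc t * S₁ + suc (suc t) * S₀)) (∑-subsetsOf-suc n t (h ∘ (true ∷_))) ⟨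
  S₁ + (suc t * S₁ + suc (suc t) * S₀)
    ≡⟨ arith′ S₁ S₀ t ⟩
  suc (suc t) * (S₁ + S₀)
    ≡⟨ cong (suc (suc t) *_) (∑-subsetsOf-suc (suc n) (suc t) h) ⟨
  suc (suc t) * ∑ (subsetsOf (suc (suc n)) (suc (suc t))) h ∎
  where
  open ≡-Reasoning
  S₁ = ∑ (subsetsOf (suc n) (suc t)) (h ∘ (true ∷_))
  S₀ = ∑ (subsetsOf (suc n) (suc (suc t))) (h ∘ (false ∷_))
  arith : ∀ a b c d s → (a + s * c) + (b + suc s * d) ≡ (a + b) + (s * c + suc s * d)
  arith = solve-∀
  arith′ : ∀ a b s → a + (suc s * a + suc (suc s) * b) ≡ suc (suc s) * (a + b)
  arith′ = solve-∀

-- Here the deleted entry is one of the `suc n ∸ t` zeros. Where the subtraction is truncated, both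
-- sides are zero.
∑-insertions-false : ∀ n t h →
  ∑[ A ← subsetsOf n t ] ∑ (insertions false A) h ≡ (suc n ∸ t) * ∑ (subsetsOf (suc n) t) h
∑-insertions-false zero zero    h = arith (h (false ∷ []))
  where
  arith : ∀ a → a + 0 + 0 ≡ 1 * (a + 0)
  arith = solve-∀
∑-insertions-false zero (suc t) h rewrite 0∸n≡0 t = refl
∑-insertions-false (suc n) zero h = begin
  ∑[ A ← subsetsOf (suc n) 0 ] ∑ (insertions false A) h
    ≡⟨ ∑-subsetsOf-zero n _ ⟩
  ∑[ A ← subsetsOf n 0 ] ∑ (insertions false (false ∷ A)) h
    ≡⟨ trans (∑-cong (subsetsOf n 0) (λ A → ∑-insertions-∷ false false A h)) (∑-+ (subsetsOf n 0) _ _) ⟩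
  ∑[ A ← subsetsOf n 0 ] h (false ∷ false ∷ A) + ∑[ A ← subsetsOf n 0 ] ∑ (insertions false A) (h ∘ (false ∷_))
    ≡⟨ cong₂ _+_ (sym (∑-subsetsOf-zero n (h ∘ (false ∷_)))) (∑-insertions-false n 0 (h ∘ (false ∷_))) ⟩
  ∑ (subsetsOf (suc n) 0) (h ∘ (false ∷_)) + suc n * ∑ (subsetsOf (suc n) 0) (h ∘ (false ∷_))
    ≡⟨⟩
  suc (suc n) * ∑ (subsetsOf (suc n) 0) (h ∘ (false ∷_))
    ≡⟨ cong (suc (suc n) *_) (∑-subsetsOf-zero (suc n) h) ⟨
  suc (suc n) * ∑ (subsetsOf (suc (suc n)) 0) h ∎
  where open ≡-Reasoning
∑-insertions-false (suc n) (suc t) h = begin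
  ∑[ A ← subsetsOf (suc n) (suc t) ] ∑ (insertions false A) h
    ≡⟨ ∑-subsetsOf-suc n t _ ⟩
  ∑[ A ← subsetsOf n t ] ∑ (insertions false (true ∷ A)) h
  + ∑[ A ← subsetsOf n (suc t) ] ∑ (insertions false (false ∷ A)) h
    ≡⟨ cong₂ _+_ (trans (∑-cong (subsetsOf n t) (λ A → ∑-insertions-∷ false true A h)) (∑-+ (subsetsOf n t) _ _))
                 (trans (∑-cong (subsetsOf n (suc t)) (λ A → ∑-insertions-∷ false false A h)) (∑-+ (subsetsOf n (suc t)) _ _)) ⟩
  (B₁ + ∑[ A ← subsetsOf n t ] ∑ (insertions false A) (h ∘ (true ∷_)))
  + (B₀ + ∑[ A ← subsetsOf n (suc t) ] ∑ (insertions false A) (h ∘ (false ∷_)))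
    ≡⟨ cong₂ (λ a b → (B₁ + a) + (B₀ + b))
             (∑-insertions-false n t (h ∘ (true ∷_))) (∑-insertions-false n (suc t) (h ∘ (false ∷_))) ⟩
  (B₁ + (suc n ∸ t) * S₁) + (B₀ + (n ∸ t) * S₀)
    ≡⟨ arith B₁ B₀ ((suc n ∸ t) * S₁) ((n ∸ t) * S₀) ⟩
  (suc n ∸ t) * S₁ + ((B₁ + B₀) + (n ∸ t) * S₀)
    ≡⟨ cong (λ s → (suc n ∸ t) * S₁ + (s + (n ∸ t) * S₀)) (∑-subsetsOf-suc n t (h ∘ (false ∷_))) ⟨
  (suc n ∸ t) * S₁ + (S₀ + (n ∸ t) * S₀)
    ≡⟨ cong ((suc n ∸ t) * S₁ +_) absorb ⟩
  (suc n ∸ t) * S₁ + (suc n ∸ t) * S₀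
    ≡⟨ *-distribˡ-+ (suc n ∸ t) S₁ S₀ ⟨
  (suc n ∸ t) * (S₁ + S₀)
    ≡⟨ cong ((suc n ∸ t) *_) (∑-subsetsOf-suc (suc n) t h) ⟨
  (suc n ∸ t) * ∑ (subsetsOf (suc (suc n)) (suc t)) h ∎
  where
  open ≡-Reasoning
  B₁ = ∑[ A ← subsetsOf n t ] h (false ∷ true ∷ A)
  B₀ = ∑[ A ← subsetsOf n (suc t) ] h (false ∷ false ∷ A)
  S₁ = ∑ (subsetsOf (suc n) t) (h ∘ (true ∷_))
  S₀ = ∑ (subsetsOf (suc n) (suc t)) (h ∘ (false ∷_))
  arith : ∀ a b c d → (a + c) + (b + d) ≡ c + ((a + b) + d)
  arith = solve-∀
  absorb : S₀ + (n ∸ t) * S₀ ≡ (suc n ∸ t) * S₀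
  absorb with t ≤? n
  ... | yes t≤n rewrite +-∸-assoc 1 t≤n = refl
  ... | no  t≰n rewrite subsetsOf-empty (suc n) (suc t) (s≤s (≰⇒> t≰n)) | *-zeroʳ (n ∸ t) | *-zeroʳ (suc n ∸ t) = refl

-- Each set of the same size as `v` is reached by permuting the ones and the zeros of `v`
-- separately, hence equally often.
∑-perms : ∀ {k} (v : Vec Bool k) h →
          ∑ (perms v) h ≡ (∣ v ∣ ! * (k ∸ ∣ v ∣) !) * ∑ (subsetsOf k ∣ v ∣) h
∑-perms []          h = sym (*-identityˡ _)
∑-perms {suc k} (true ∷ v) h = begin
  ∑ (concatMap (insertions true) (perms v)) h    ≡⟨ ∑-concatMap _ (perms v) h ⟩
  ∑[ w ← perms v ] ∑ (insertions true w) h       ≡⟨ ∑-perms v _ ⟩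
  c * ∑[ A ← subsetsOf k t ] ∑ (insertions true A) h ≡⟨ cong (c *_) (∑-insertions-true k t h) ⟩
  c * (suc t * ∑ (subsetsOf (suc k) (suc t)) h)  ≡⟨ arith (t !) ((k ∸ t) !) (suc t) _ ⟩
  suc t * t ! * (k ∸ t) ! * ∑ (subsetsOf (suc k) (suc t)) h ∎
  where
  open ≡-Reasoning
  t = ∣ v ∣
  c = t ! * (k ∸ t) !
  arith : ∀ a b s x → a * b * (s * x) ≡ s * a * b * x
  arith = solve-∀
∑-perms {suc k} (false ∷ v) h = begin
  ∑ (concatMap (insertions false) (perms v)) h   ≡⟨ ∑-concatMap _ (perms v) h ⟩
  ∑[ w ← perms v ] ∑ (insertions false w) h      ≡⟨ ∑-perms v _ ⟩
  c * ∑[ A ← subsetsOf k t ] ∑ (insertions false A) h ≡⟨ cong (c *_) (∑-insertions-false k t h) ⟩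
  c * ((suc k ∸ t) * ∑ (subsetsOf (suc k) t) h)  ≡⟨ arith (t !) ((k ∸ t) !) (suc k ∸ t) _ ⟩
  t ! * ((suc k ∸ t) * (k ∸ t) !) * ∑ (subsetsOf (suc k) t) h ≡⟨ cong (λ s → t ! * s * ∑ (subsetsOf (suc k) t) h) fact ⟩
  t ! * (suc k ∸ t) ! * ∑ (subsetsOf (suc k) t) h ∎
  where
  open ≡-Reasoning
  t = ∣ v ∣
  c = t ! * (k ∸ t) !
  fact : (suc k ∸ t) * (k ∸ t) ! ≡ (suc k ∸ t) !
  fact rewrite +-∸-assoc 1 (∣p∣≤n v) = refl
  arith : ∀ a b s x → a * b * (s * x) ≡ a * (s * b) * x
  arith = solve-∀

-- Cyclic rotation

module _ {X : Set} where

  rot : ∀ {n} → Vec X (suc n) → Vec X (suc n)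
  rot (x ∷ v) = v ∷ʳ x

  rots : ∀ {n} → ℕ → Vec X (suc n) → Vec X (suc n)
  rots zero    v = v
  rots (suc t) v = rot (rots t v)

  lookup-∷ʳ-inject₁ : ∀ {n} (v : Vec X n) x i → lookup (v ∷ʳ x) (inject₁ i) ≡ lookup v i
  lookup-∷ʳ-inject₁ (y ∷ v) x zero    = refl
  lookup-∷ʳ-inject₁ (y ∷ v) x (suc i) = lookup-∷ʳ-inject₁ v x i

  lookup-rot : ∀ {n} (v : Vec X (suc n)) i → lookup (rot v) (inject₁ i) ≡ lookup v (suc i)
  lookup-rot (x ∷ v) i = lookup-∷ʳ-inject₁ v x i

  lookup-rots : ∀ {n} (v : Vec X (suc n)) t i → lookup (rots t v) i ≡ head (rots (toℕ i + t) v)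
  lookup-rots v t i = go (toℕ i) t i refl
    where
    go : ∀ j t i → toℕ i ≡ j → lookup (rots t v) i ≡ head (rots (j + t) v)
    go zero    t zero    eq with rots t v
    ... | x ∷ u = refl
    go (suc j) t (suc i) eq = begin
      lookup (rots t v) (suc i)                ≡⟨ lookup-rot (rots t v) i ⟨
      lookup (rots (suc t) v) (inject₁ i)      ≡⟨ go j (suc t) (inject₁ i) (trans (Fin.toℕ-inject₁ i) (suc-injective eq)) ⟩
      head (rots (j + suc t) v)                ≡⟨ cong (λ s → head (rots s v)) (+-suc j t) ⟩
      head (rots (suc j + t) v)                ∎
      where open ≡-Reasoning

  -- The circulant matrix of `v` is symmetric, because its entries depend on the sum of the two
  -- indices only.
  lookup-rots-comm : ∀ {n} (v : Vec X (suc n)) i j →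
                     lookup (rots (toℕ i) v) j ≡ lookup (rots (toℕ j) v) i
  lookup-rots-comm v i j = begin
    lookup (rots (toℕ i) v) j   ≡⟨ lookup-rots v (toℕ i) j ⟩
    head (rots (toℕ j + toℕ i) v) ≡⟨ cong (λ s → head (rots s v)) (+-comm (toℕ j) (toℕ i)) ⟩
    head (rots (toℕ i + toℕ j) v) ≡⟨ lookup-rots v (toℕ j) i ⟨
    lookup (rots (toℕ j) v) i   ∎
    where open ≡-Reasoning

  ∑-∷ʳ : ∀ n (L : List X) h → ∑ (L ^ᴸ suc n) h ≡ ∑[ x ← L ] ∑[ v ← L ^ᴸ n ] h (v ∷ʳ x)
  ∑-∷ʳ zero    L h = ∑-∏ L [] h
  ∑-∷ʳ (suc n) L h = begin
    ∑ (L ^ᴸ suc (suc n)) h                                ≡⟨ ∑-^ᴸ (suc n) L h ⟩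
    ∑[ y ← L ] ∑[ u ← L ^ᴸ suc n ] h (y ∷ u)              ≡⟨ ∑-cong L (λ y → ∑-∷ʳ n L (h ∘ (y ∷_))) ⟩
    ∑[ y ← L ] ∑[ x ← L ] ∑[ v ← L ^ᴸ n ] h (y ∷ (v ∷ʳ x))  ≡⟨ ∑-swap L L _ ⟩
    ∑[ x ← L ] ∑[ y ← L ] ∑[ v ← L ^ᴸ n ] h (y ∷ (v ∷ʳ x))  ≡⟨ ∑-cong L (λ x → ∑-^ᴸ n L (λ v → h (v ∷ʳ x))) ⟨
    ∑[ x ← L ] ∑[ v ← L ^ᴸ suc n ] h (v ∷ʳ x)             ∎
    where open ≡-Reasoning

  ∑-rot : ∀ n (L : List X) h → ∑ (L ^ᴸ suc n) (h ∘ rot) ≡ ∑ (L ^ᴸ suc n) h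
  ∑-rot n L h = trans (∑-^ᴸ n L (h ∘ rot)) (sym (∑-∷ʳ n L h))

  ∑-rots : ∀ n t (L : List X) h → ∑ (L ^ᴸ suc n) (h ∘ rots t) ≡ ∑ (L ^ᴸ suc n) h
  ∑-rots n zero    L h = refl
  ∑-rots n (suc t) L h = trans (∑-rots n t L (h ∘ rot)) (∑-rot n L h)

sum-∷ʳ : ∀ {n} (v : Vec ℕ n) x → sum (v ∷ʳ x) ≡ x + sum v
sum-∷ʳ []      x = refl
sum-∷ʳ (y ∷ v) x rewrite sum-∷ʳ v x = x∙yz≈y∙xz y x (sum v)

product-∷ʳ : ∀ {n} (v : Vec ℕ n) x → product (v ∷ʳ x) ≡ x * product v
product-∷ʳ []      x = refl
product-∷ʳ (y ∷ v) x rewrite product-∷ʳ v x = arith y x (product v)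
  where
  arith : ∀ a b c → a * (b * c) ≡ b * (a * c)
  arith = solve-∀

sum-rots : ∀ {n} t (v : Vec ℕ (suc n)) → sum (rots t v) ≡ sum v
sum-rots zero    v = refl
sum-rots (suc t) v = trans (sum-rot (rots t v)) (sum-rots t v)
  where
  sum-rot : ∀ {n} (v : Vec ℕ (suc n)) → sum (rot v) ≡ sum v
  sum-rot (x ∷ v) = sum-∷ʳ v x

product-map-rots : ∀ {n} (f : ℕ → ℕ) t (v : Vec ℕ (suc n)) → product (map f (rots t v)) ≡ product (map f v)
product-map-rots f zero    v = refl
product-map-rots f (suc t) v = trans (product-rot (rots t v)) (product-map-rots f t v)
  where
  product-rot : ∀ {n} (v : Vec ℕ (suc n)) → product (map f (rot v)) ≡ product (map f v)
  product-rot (x ∷ v) = trans (cong product (Vec.map-∷ʳ f x v)) (product-∷ʳ (map f v) (f x))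

-- Colourings

is : ∀ {n} → Fin n → Fin n → Bool
is t s = does (s Fin.≟ t)

∣++∣ : ∀ {m n} (u : Vec Bool m) (v : Vec Bool n) → ∣ u Vec.++ v ∣ ≡ ∣ u ∣ + ∣ v ∣
∣++∣ []          v = refl
∣++∣ (true ∷ u)  v = cong suc (∣++∣ u v)
∣++∣ (false ∷ u) v = ∣++∣ u v

∣replicate-true∣ : ∀ n → ∣ replicate n true ∣ ≡ n
∣replicate-true∣ zero    = refl
∣replicate-true∣ (suc n) = cong suc (∣replicate-true∣ n)

∣replicate-false∣ : ∀ n → ∣ replicate n false ∣ ≡ 0
∣replicate-false∣ zero    = refl
∣replicate-false∣ (suc n) = ∣replicate-false∣ n

-- The sorted word in which letter t occurs `lookup c t` times. Its order is immaterial, since all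
-- its permutations will be taken.
word : ∀ {ℓ} (c : Vec ℕ ℓ) → Vec (Fin ℓ) (sum c)
word []      = []
word (x ∷ c) = replicate x zero Vec.++ map suc (word c)

∣word∣ : ∀ {ℓ} (c : Vec ℕ ℓ) t → ∣ map (is t) (word c) ∣ ≡ lookup c t
∣word∣ (x ∷ c) t = begin
  ∣ map (is t) (replicate x zero Vec.++ map suc (word c)) ∣
    ≡⟨ cong ∣_∣ (Vec.map-++ (is t) (replicate x zero) (map suc (word c))) ⟩
  ∣ map (is t) (replicate x zero) Vec.++ map (is t) (map suc (word c)) ∣
    ≡⟨ ∣++∣ (map (is t) (replicate x zero)) _ ⟩
  ∣ map (is t) (replicate x zero) ∣ + ∣ map (is t) (map suc (word c)) ∣
    ≡⟨ cong₂ (λ u v → ∣ u ∣ + ∣ v ∣) (Vec.map-replicate (is t) zero x) (sym (Vec.map-∘ (is t) suc (word c))) ⟩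
  ∣ replicate x (is t zero) ∣ + ∣ map (is t ∘ suc) (word c) ∣
    ≡⟨ split t ⟩
  lookup (x ∷ c) t ∎
  where
  open ≡-Reasoning
  split : ∀ t → ∣ replicate x (is t zero) ∣ + ∣ map (is t ∘ suc) (word c) ∣ ≡ lookup (x ∷ c) t
  split zero    = trans (cong₂ _+_ (∣replicate-true∣ x)
                    (trans (cong ∣_∣ (Vec.map-const (word c) false)) (∣replicate-false∣ (sum c))))
                    (+-identityʳ x)
  split (suc t) = cong₂ _+_ (∣replicate-false∣ x) (∣word∣ c t)

wordOf : ∀ {ℓ k} (c : Vec ℕ ℓ) → sum c ≡ k → Σ (Vec (Fin ℓ) k) λ w → ∀ t → ∣ map (is t) w ∣ ≡ lookup c t
wordOf c refl = word c , ∣word∣ c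

Matrix : ℕ → ℕ → Set
Matrix ℓ k = Vec (Vec Bool k) ℓ

-- A frame is encoded as a colouring of the cells with its members as colour classes, so that being
-- a partition holds by construction.
class : ∀ {ℓ n k} → Fin ℓ → Vec (Vec (Fin ℓ) k) n → Matrix n k
class t = map (map (is t))

withRowSizes : ∀ {n} k → Vec ℕ n → List (Matrix n k)
withRowSizes k a = ∏ (map (subsetsOf k) a)

-- A frame puts into row i a word containing colour t exactly lookup (rots i a) t times, so that
-- class t has the row sizes rots t a.
frames : ∀ {l k} (a : Vec ℕ (suc l)) → sum a ≡ k →
  ∃[ F ] ∃[ K ] (0 < K × (∀ t h → ∑ F (h ∘ class t) ≡ K * ∑ (withRowSizes k (rots (toℕ t) a)) h))
frames {l} {k} a eq = F , K , product-pos a , balanced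
  where
  weight : ℕ → ℕ
  weight n = n ! * (k ∸ n) !
  W : (i : Fin (suc l)) → Σ (Vec (Fin (suc l)) k) λ w → ∀ t → ∣ map (is t) w ∣ ≡ lookup (rots (toℕ i) a) t
  W i = wordOf (rots (toℕ i) a) (trans (sum-rots (toℕ i) a) eq)
  F = ∏ (tabulate (perms ∘ proj₁ ∘ W))
  -- The number of choices of row permutations that give one prescribed matrix as a fixed class. It
  -- does not depend on the class, as rotating `a` only reorders the factors.
  K = product (map weight a)
  product-pos : ∀ {n} (v : Vec ℕ n) → 0 < product (map weight v)
  product-pos []      = s≤s z≤n
  product-pos (x ∷ v) = *-mono-< (*-mono-< (1≤n! x) (1≤n! (k ∸ x))) (product-pos v)
  balanced : ∀ t h → ∑ F (h ∘ class t) ≡ K * ∑ (withRowSizes k (rots (toℕ t) a)) h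
  balanced t h = begin
    ∑ F (h ∘ class t)
      ≡⟨ ∑-∏-scale (map (is t)) (tabulate (perms ∘ proj₁ ∘ W)) (map (subsetsOf k) a′) (map weight a′) row h ⟩
    product (map weight a′) * ∑ (withRowSizes k a′) h
      ≡⟨ cong (_* ∑ (withRowSizes k a′) h) (product-map-rots weight (toℕ t) a) ⟩
    K * ∑ (withRowSizes k a′) h ∎
    where
    open ≡-Reasoning
    a′ = rots (toℕ t) a
    row : ∀ i g → ∑ (lookup (tabulate (perms ∘ proj₁ ∘ W)) i) (g ∘ map (is t))
                  ≡ lookup (map weight a′) i * ∑ (lookup (map (subsetsOf k) a′) i) g
    row i g = begin
      ∑ (lookup (tabulate (perms ∘ proj₁ ∘ W)) i) (g ∘ map (is t))
        ≡⟨ cong (λ L → ∑ L (g ∘ map (is t))) (Vec.lookup∘tabulate (perms ∘ proj₁ ∘ W) i) ⟩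
      ∑ (perms w) (g ∘ map (is t))
        ≡⟨ ∑-perms-map (is t) w g ⟩
      ∑ (perms (map (is t) w)) g
        ≡⟨ ∑-perms (map (is t) w) g ⟩
      weight ∣ map (is t) w ∣ * ∑ (subsetsOf k ∣ map (is t) w ∣) g
        -- Row i has `lookup (rots i a) t` cells of colour t; symmetry of the circulant turns this
        -- into entry i of `rots t a`.
        ≡⟨ cong (λ s → weight s * ∑ (subsetsOf k s) g) (trans (proj₂ (W i) t) (lookup-rots-comm a i t)) ⟩
      weight (lookup a′ i) * ∑ (subsetsOf k (lookup a′ i)) g
        ≡⟨ cong₂ (λ s L → s * ∑ L g) (Vec.lookup-map i weight a′) (Vec.lookup-map i (subsetsOf k) a′) ⟨
      lookup (map weight a′) i * ∑ (lookup (map (subsetsOf k) a′) i) g ∎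
      where w = proj₁ (W i)

-- Averaging over frames

∑-const : ∀ {X : Set} (xs : List X) c → ∑[ _ ← xs ] c ≡ length xs * c
∑-const []       c = refl
∑-const (x ∷ xs) c = cong (c +_) (∑-const xs c)

-- The relation is abstract because the argument is used twice: with ≤ for a weight that gives at
-- least 1 to each frame, and with equality for a weight that gives exactly 1.
module Averaging (_~_ : ℕ → ℕ → Set) (~-refl : ∀ {m} → m ~ m)
                 (+-resp : ∀ {m n p q} → m ~ n → p ~ q → (m + p) ~ (n + q))
                 (*-cancel : ∀ {m n} K → 0 < K → (K * m) ~ (K * n) → m ~ n) where

  ∑-resp : ∀ {X : Set} (xs : List X) {g h : X → ℕ} → (∀ x → g x ~ h x) → (∑ xs g) ~ (∑ xs h)
  ∑-resp []       r = ~-refl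
  ∑-resp (x ∷ xs) r = +-resp (r x) (∑-resp xs r)

  when : ∀ {P : Set} {m n} (p? : Dec P) → (P → m ~ n) → (⟦ does p? ⟧ * m) ~ (⟦ does p? ⟧ * n)
  when (yes p) r = +-resp (r p) ~-refl
  when (no _)  r = ~-refl

  module _ {l k} (d : Matrix (suc l) k → ℕ)
           (hit : ∀ w → 1 ~ (∑[ t ← allFin (suc l) ] d (class t w))) where

    -- Sum `hit` over the frames for `a`. The left side becomes the number of frames, the right side
    -- splits by colours, and both carry the same factor K, which cancels.
    local : ∀ a → sum a ≡ k →
            (∑[ _ ← withRowSizes k a ] 1) ~ (∑[ t ← allFin (suc l) ] ∑ (withRowSizes k (rots (toℕ t) a)) d)
    local a eq with frames a eq
    ... | F , K , K>0 , balanced = *-cancel K K>0 (subst₂ _~_ lhs rhs (∑-resp F hit))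
      where
      open ≡-Reasoning
      lhs : ∑[ _ ← F ] 1 ≡ K * ∑[ _ ← withRowSizes k a ] 1
      -- Colour zero has row sizes `a` itself, and the constant weight 1 counts the frames.
      lhs = balanced zero (λ _ → 1)
      rhs : ∑[ w ← F ] ∑[ t ← allFin (suc l) ] d (class t w)
            ≡ K * ∑[ t ← allFin (suc l) ] ∑ (withRowSizes k (rots (toℕ t) a)) d
      rhs = begin
        ∑[ w ← F ] ∑[ t ← allFin (suc l) ] d (class t w)  ≡⟨ ∑-swap F (allFin (suc l)) _ ⟩
        ∑[ t ← allFin (suc l) ] ∑ F (d ∘ class t)         ≡⟨ ∑-cong (allFin (suc l)) (λ t → balanced t d) ⟩
        ∑[ t ← allFin (suc l) ] (K * ∑ (withRowSizes k (rots (toℕ t) a)) d) ≡⟨ ∑-*ˡ K (allFin (suc l)) _ ⟩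
        K * ∑[ t ← allFin (suc l) ] ∑ (withRowSizes k (rots (toℕ t) a)) d ∎

    -- Both the power of `J` and the condition on the sum are invariant under rotation, so after
    -- summing over `a` the `suc l` colours contribute equally. This is the origin of the factor ℓ.
    total : (J : List ℕ) →
      (∑[ a ← J ^ᴸ suc l ] (⟦ does (sum a ≟ k) ⟧ * ∑[ _ ← withRowSizes k a ] 1))
      ~ (suc l * ∑[ a ← J ^ᴸ suc l ] (⟦ does (sum a ≟ k) ⟧ * ∑ (withRowSizes k a) d))
    total J = subst (_ ~_) eq (∑-resp (J ^ᴸ suc l) termwise)
      where
      open ≡-Reasoning
      T′ = allFin (suc l)
      summand : Vec ℕ (suc l) → ℕ
      summand a = ⟦ does (sum a ≟ k) ⟧ * ∑ (withRowSizes k a) d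
      termwise : ∀ a → (⟦ does (sum a ≟ k) ⟧ * ∑[ _ ← withRowSizes k a ] 1)
                       ~ (⟦ does (sum a ≟ k) ⟧ * ∑[ t ← T′ ] ∑ (withRowSizes k (rots (toℕ t) a)) d)
      termwise a = when (sum a ≟ k) (local a)
      eq : ∑[ a ← J ^ᴸ suc l ] (⟦ does (sum a ≟ k) ⟧ * ∑[ t ← T′ ] ∑ (withRowSizes k (rots (toℕ t) a)) d)
           ≡ suc l * ∑ (J ^ᴸ suc l) summand
      eq = begin
        ∑[ a ← J ^ᴸ suc l ] (⟦ does (sum a ≟ k) ⟧ * ∑[ t ← T′ ] ∑ (withRowSizes k (rots (toℕ t) a)) d)
          ≡⟨ ∑-cong (J ^ᴸ suc l) (λ a → ∑-*ˡ ⟦ does (sum a ≟ k) ⟧ T′ _) ⟨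
        ∑[ a ← J ^ᴸ suc l ] ∑[ t ← T′ ] (⟦ does (sum a ≟ k) ⟧ * ∑ (withRowSizes k (rots (toℕ t) a)) d)
          ≡⟨ ∑-swap (J ^ᴸ suc l) T′ _ ⟩
        ∑[ t ← T′ ] ∑[ a ← J ^ᴸ suc l ] (⟦ does (sum a ≟ k) ⟧ * ∑ (withRowSizes k (rots (toℕ t) a)) d)
          ≡⟨ ∑-cong T′ (λ t → ∑-cong (J ^ᴸ suc l) (λ a →
               cong (λ s → ⟦ does (s ≟ k) ⟧ * ∑ (withRowSizes k (rots (toℕ t) a)) d) (sum-rots (toℕ t) a))) ⟨
        ∑[ t ← T′ ] ∑ (J ^ᴸ suc l) (summand ∘ rots (toℕ t))
          ≡⟨ ∑-cong T′ (λ t → ∑-rots l (toℕ t) J summand) ⟩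
        ∑[ t ← T′ ] ∑ (J ^ᴸ suc l) summand
          ≡⟨ ∑-const T′ _ ⟩
        length T′ * ∑ (J ^ᴸ suc l) summand
          ≡⟨ cong (_* ∑ (J ^ᴸ suc l) summand) (List.length-tabulate {n = suc l} id) ⟩
        suc l * ∑ (J ^ᴸ suc l) summand ∎

*-cancel-≤ : ∀ {m n} K → 0 < K → K * m ≤ K * n → m ≤ n
*-cancel-≤ (suc K) _ = *-cancelˡ-≤ (suc K)

*-cancel-≡ : ∀ {m n} K → 0 < K → K * m ≡ K * n → m ≡ n
*-cancel-≡ (suc K) _ = *-cancelˡ-≡ _ _ (suc K)

module Averaging-≤ = Averaging _≤_ ≤-refl +-mono-≤ *-cancel-≤
module Averaging-≡ = Averaging _≡_ refl (cong₂ _+_) *-cancel-≡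

-- Matrices sorted by support and by row sizes

bits : ∀ n → List (Vec Bool n)
bits n = (true ∷ false ∷ []) ^ᴸ n

∑-bits-suc : ∀ n h → ∑ (bits (suc n)) h ≡ ∑ (bits n) (h ∘ (true ∷_)) + ∑ (bits n) (h ∘ (false ∷_))
∑-bits-suc n h = trans (∑-^ᴸ n (true ∷ false ∷ []) h)
                       (cong (∑ (bits n) (h ∘ (true ∷_)) +_) (+-identityʳ _))

∑-applyUpTo : ∀ {X Y : Set} (g : X → Y) (f : ℕ → X) n h → ∑ (applyUpTo (g ∘ f) n) h ≡ ∑ (applyUpTo f n) (h ∘ g)
∑-applyUpTo g f zero    h = refl
∑-applyUpTo g f (suc n) h = cong (h (g (f 0)) +_) (∑-applyUpTo g (f ∘ suc) n h)

∑-upTo-suc : ∀ n h → ∑ (upTo (suc n)) h ≡ h 0 + ∑ (upTo n) (h ∘ suc)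
∑-upTo-suc n h = cong (h 0 +_) (∑-applyUpTo suc id n h)

-- The range of sizes may exceed n, since the induction removes an entry without always lowering the
-- size; the excess terms are empty.
∑-bits : ∀ n N → n ≤ N → ∀ h → ∑[ t ← upTo (suc N) ] ∑ (subsetsOf n t) h ≡ ∑ (bits n) h
∑-bits zero N _ h = begin
  ∑[ t ← upTo (suc N) ] ∑ (subsetsOf 0 t) h  ≡⟨ ∑-upTo-suc N _ ⟩
  h [] + 0 + ∑[ _ ← upTo N ] 0               ≡⟨ cong (h [] + 0 +_) (∑-0 (upTo N)) ⟩
  h [] + 0 + 0                               ≡⟨ +-identityʳ _ ⟩
  h [] + 0 ∎
  where open ≡-Reasoning
∑-bits (suc n) (suc N) (s≤s n≤N) h = begin
  ∑[ t ← upTo (suc (suc N)) ] ∑ (subsetsOf (suc n) t) h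
    ≡⟨ ∑-upTo-suc (suc N) (λ t → ∑ (subsetsOf (suc n) t) h) ⟩
  ∑ (subsetsOf (suc n) 0) h + ∑[ t ← upTo (suc N) ] ∑ (subsetsOf (suc n) (suc t)) h
    ≡⟨ cong₂ _+_ (∑-subsetsOf-zero n h) (trans (∑-cong (upTo (suc N)) (λ t → ∑-subsetsOf-suc n t h)) (∑-+ (upTo (suc N)) (λ t → ∑ (subsetsOf n t) h₁) (λ t → ∑ (subsetsOf n (suc t)) h₀))) ⟩
  z + (s₁ + ∑[ t ← upTo (suc N) ] ∑ (subsetsOf n (suc t)) h₀)
    ≡⟨ x∙yz≈y∙xz z s₁ _ ⟩
  s₁ + (z + ∑[ t ← upTo (suc N) ] ∑ (subsetsOf n (suc t)) h₀)
    ≡⟨ cong (s₁ +_) (∑-upTo-suc (suc N) (λ t → ∑ (subsetsOf n t) h₀)) ⟨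
  s₁ + ∑[ t ← upTo (suc (suc N)) ] ∑ (subsetsOf n t) h₀
    ≡⟨ cong₂ _+_ (∑-bits n N n≤N h₁) (∑-bits n (suc N) (m≤n⇒m≤1+n n≤N) h₀) ⟩
  ∑ (bits n) h₁ + ∑ (bits n) h₀
    ≡⟨ ∑-bits-suc n h ⟨
  ∑ (bits (suc n)) h ∎
  where
  open ≡-Reasoning
  h₁ = h ∘ (true ∷_)
  h₀ = h ∘ (false ∷_)
  z  = ∑ (subsetsOf n 0) h₀
  s₁ = ∑[ t ← upTo (suc N) ] ∑ (subsetsOf n t) h₁

-- Listed by size from 1 to k, so that powers of this list regroup by vectors of row sizes with
-- positive entries, the form in which `total` applies.
nonempty : ∀ k → List (Vec Bool k)
nonempty k = concatMap (subsetsOf k) (applyUpTo suc k)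

zeros : ∀ k → Vec Bool k
zeros k = replicate k false

∑-subsetsOf-0 : ∀ k h → ∑ (subsetsOf k 0) h ≡ h (zeros k)
∑-subsetsOf-0 zero    h = +-identityʳ _
∑-subsetsOf-0 (suc k) h = trans (∑-subsetsOf-zero k h) (∑-subsetsOf-0 k _)

∑-bits-nonempty : ∀ k h → ∑ (bits k) h ≡ h (zeros k) + ∑ (nonempty k) h
∑-bits-nonempty k h = begin
  ∑ (bits k) h                                                     ≡⟨ ∑-bits k k ≤-refl h ⟨
  ∑ (subsetsOf k 0) h + ∑[ t ← applyUpTo suc k ] ∑ (subsetsOf k t) h ≡⟨ cong₂ _+_ (∑-subsetsOf-0 k h) (sym (∑-concatMap (subsetsOf k) (applyUpTo suc k) h)) ⟩
  h (zeros k) + ∑ (nonempty k) h                                   ∎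
  where open ≡-Reasoning

-- Puts back the empty rows: with all rows of `A` non-empty, this is the general matrix with support
-- `S`. Matrices on ∣ S ∣ rows thus serve all supports of that size at once.
expand : ∀ {m k} (S : Vec Bool m) → Matrix ∣ S ∣ k → Matrix m k
expand []          A       = []
expand (true ∷ S)  (r ∷ A) = r ∷ expand S A
expand (false ∷ S) A       = zeros _ ∷ expand S A

∑-bySupport : ∀ m k h → ∑ (bits k ^ᴸ m) h ≡ ∑[ S ← bits m ] ∑ (nonempty k ^ᴸ ∣ S ∣) (h ∘ expand S)
∑-bySupport zero    k h = sym (+-identityʳ _)
∑-bySupport (suc m) k h = begin
  ∑ (bits k ^ᴸ suc m) h
    ≡⟨ ∑-^ᴸ m (bits k) h ⟩
  ∑[ r ← bits k ] ∑[ A ← bits k ^ᴸ m ] h (r ∷ A)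
    ≡⟨ ∑-bits-nonempty k _ ⟩
  ∑[ A ← bits k ^ᴸ m ] h (zeros k ∷ A) + ∑[ r ← nonempty k ] ∑[ A ← bits k ^ᴸ m ] h (r ∷ A)
    ≡⟨ cong₂ _+_ (∑-bySupport m k _) (∑-cong (nonempty k) (λ r → ∑-bySupport m k (h ∘ (r ∷_)))) ⟩
  s₀ + ∑[ r ← nonempty k ] ∑[ S ← bits m ] ∑[ A ← nonempty k ^ᴸ ∣ S ∣ ] h (r ∷ expand S A)
    ≡⟨ cong (s₀ +_) (∑-swap (nonempty k) (bits m) _) ⟩
  s₀ + ∑[ S ← bits m ] ∑[ r ← nonempty k ] ∑[ A ← nonempty k ^ᴸ ∣ S ∣ ] h (r ∷ expand S A)
    ≡⟨ cong (s₀ +_) (∑-cong (bits m) (λ S → ∑-^ᴸ ∣ S ∣ (nonempty k) (h ∘ expand (true ∷ S)))) ⟨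
  s₀ + ∑[ S ← bits m ] ∑ (nonempty k ^ᴸ suc ∣ S ∣) (h ∘ expand (true ∷ S))
    ≡⟨ +-comm s₀ _ ⟩
  ∑[ S ← bits m ] ∑ (nonempty k ^ᴸ suc ∣ S ∣) (h ∘ expand (true ∷ S)) + s₀
    ≡⟨ ∑-bits-suc m (λ S → ∑ (nonempty k ^ᴸ ∣ S ∣) (h ∘ expand S)) ⟨
  ∑[ S ← bits (suc m) ] ∑ (nonempty k ^ᴸ ∣ S ∣) (h ∘ expand S) ∎
  where
  open ≡-Reasoning
  s₀ = ∑[ S ← bits m ] ∑ (nonempty k ^ᴸ ∣ S ∣) (h ∘ expand (false ∷ S))

-- The binomial transform, that is the sum of C(m,ℓ) G(ℓ) over ℓ, written by Pascal's rule. In this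
-- form its difference in m is visibly the transform of the shifted G.
binomialSum : (ℕ → ℕ) → ℕ → ℕ
binomialSum G zero    = G 0
binomialSum G (suc m) = binomialSum (G ∘ suc) m + binomialSum G m

∑-bits-size : ∀ m G → ∑[ S ← bits m ] G ∣ S ∣ ≡ binomialSum G m
∑-bits-size zero    G = +-identityʳ (G 0)
∑-bits-size (suc m) G = trans (∑-bits-suc m (λ S → G ∣ S ∣))
                              (cong₂ _+_ (∑-bits-size m (G ∘ suc)) (∑-bits-size m G))

size : ∀ {m k} → Matrix m k → ℕ
size A = sum (map ∣_∣ A)

size-expand : ∀ {m k} (S : Vec Bool m) (A : Matrix ∣ S ∣ k) → size (expand S A) ≡ size A
size-expand []          []      = refl
size-expand (true ∷ S)  (r ∷ A) = cong (∣ r ∣ +_) (size-expand S A)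
size-expand {k = k} (false ∷ S) A rewrite ∣replicate-false∣ k = size-expand S A

∈-subsetsOf⁻ : ∀ n t {v} → v ∈ subsetsOf n t → ∣ v ∣ ≡ t
∈-subsetsOf⁻ zero    zero    (here refl) = refl
∈-subsetsOf⁻ (suc n) zero    v∈ with ∈-map⁻ (false ∷_) v∈
... | u , u∈ , refl = ∈-subsetsOf⁻ n 0 u∈
∈-subsetsOf⁻ (suc n) (suc t) v∈ with ∈-++⁻ (List.map (true ∷_) (subsetsOf n t)) v∈
... | inj₁ v∈₁ with ∈-map⁻ (true ∷_) v∈₁
...   | u , u∈ , refl = cong suc (∈-subsetsOf⁻ n t u∈)
∈-subsetsOf⁻ (suc n) (suc t) v∈ | inj₂ v∈₀ with ∈-map⁻ (false ∷_) v∈₀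
...   | u , u∈ , refl = ∈-subsetsOf⁻ n (suc t) u∈

∈-withRowSizes⁻ : ∀ {n} k (a : Vec ℕ n) {A} → A ∈ withRowSizes k a → size A ≡ sum a
∈-withRowSizes⁻ k []      (here refl) = refl
∈-withRowSizes⁻ k (x ∷ a) A∈ with ∈-cartesianProductWith⁻ _∷_ (subsetsOf k x) (withRowSizes k a) A∈
... | r , A , r∈ , A∈′ , refl = cong₂ _+_ (∈-subsetsOf⁻ k x r∈) (∈-withRowSizes⁻ k a A∈′)

Nonempty : ∀ {k} → Vec Bool k → Set
Nonempty r = ∣ r ∣ ≢ 0

∈-nonempty⁻ : ∀ k {r} → r ∈ nonempty k → Nonempty r
∈-nonempty⁻ k {r} r∈ eq with find (∈-concatMap⁻ (subsetsOf k) {xs = applyUpTo suc k} r∈)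
... | t , t∈ , r∈ₜ with ∈-applyUpTo⁻ suc t∈
...   | _ , _ , refl with trans (sym eq) (∈-subsetsOf⁻ k t r∈ₜ)
...     | ()

∈-nonempty^⁻ : ∀ k n {A} → A ∈ nonempty k ^ᴸ n → VecAll.All Nonempty A
∈-nonempty^⁻ k zero    (here refl) = []
∈-nonempty^⁻ k (suc n) A∈ with ∈-cartesianProductWith⁻ _∷_ (nonempty k) (nonempty k ^ᴸ n) A∈
... | r , A , r∈ , A∈′ , refl = ∈-nonempty⁻ k r∈ ∷ ∈-nonempty^⁻ k n A∈′

All-nonempty⇒≤size : ∀ {n k} {A : Matrix n k} → VecAll.All Nonempty A → n ≤ size A
All-nonempty⇒≤size []       = z≤n
All-nonempty⇒≤size (p ∷ ps) = +-mono-≤ (n≢0⇒n>0 p) (All-nonempty⇒≤size ps)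

∑-nonempty^ : ∀ k n h → ∑ (nonempty k ^ᴸ n) h ≡ ∑[ a ← applyUpTo suc k ^ᴸ n ] ∑ (withRowSizes k a) h
∑-nonempty^ k zero    h = sym (+-identityʳ _)
∑-nonempty^ k (suc n) h = begin
  ∑ (nonempty k ^ᴸ suc n) h
    ≡⟨ ∑-^ᴸ n (nonempty k) h ⟩
  ∑[ r ← nonempty k ] ∑[ A ← nonempty k ^ᴸ n ] h (r ∷ A)
    ≡⟨ ∑-concatMap (subsetsOf k) J _ ⟩
  ∑[ x ← J ] ∑[ r ← subsetsOf k x ] ∑[ A ← nonempty k ^ᴸ n ] h (r ∷ A)
    ≡⟨ ∑-cong J (λ x → ∑-cong (subsetsOf k x) (λ r → ∑-nonempty^ k n (h ∘ (r ∷_)))) ⟩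
  ∑[ x ← J ] ∑[ r ← subsetsOf k x ] ∑[ a ← J ^ᴸ n ] ∑[ A ← withRowSizes k a ] h (r ∷ A)
    ≡⟨ ∑-cong J (λ x → ∑-swap (subsetsOf k x) (J ^ᴸ n) _) ⟩
  ∑[ x ← J ] ∑[ a ← J ^ᴸ n ] ∑[ r ← subsetsOf k x ] ∑[ A ← withRowSizes k a ] h (r ∷ A)
    ≡⟨ ∑-cong J (λ x → ∑-cong (J ^ᴸ n) (λ a → ∑-∏ (subsetsOf k x) (map (subsetsOf k) a) h)) ⟨
  ∑[ x ← J ] ∑[ a ← J ^ᴸ n ] ∑ (withRowSizes k (x ∷ a)) h
    ≡⟨ ∑-^ᴸ n J _ ⟨
  ∑[ a ← J ^ᴸ suc n ] ∑ (withRowSizes k a) h ∎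
  where
  open ≡-Reasoning
  J = applyUpTo suc k

hasSize : ∀ {m k} → Matrix m k → ℕ
hasSize {k = k} A = ⟦ does (size A ≟ k) ⟧

∑-hasSize : ∀ k n d → ∑[ A ← nonempty k ^ᴸ n ] (hasSize A * d A)
            ≡ ∑[ a ← applyUpTo suc k ^ᴸ n ] (⟦ does (sum a ≟ k) ⟧ * ∑ (withRowSizes k a) d)
∑-hasSize k n d = begin
  ∑[ A ← nonempty k ^ᴸ n ] (hasSize A * d A)
    ≡⟨ ∑-nonempty^ k n _ ⟩
  ∑[ a ← J ^ᴸ n ] ∑[ A ← withRowSizes k a ] (hasSize A * d A)
    ≡⟨ ∑-cong (J ^ᴸ n) (λ a → ∑-cong-∈ (withRowSizes k a) (λ {A} A∈ →
         cong (λ s → ⟦ does (s ≟ k) ⟧ * d A) (∈-withRowSizes⁻ k a A∈))) ⟩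
  ∑[ a ← J ^ᴸ n ] ∑[ A ← withRowSizes k a ] (⟦ does (sum a ≟ k) ⟧ * d A)
    ≡⟨ ∑-cong (J ^ᴸ n) (λ a → ∑-*ˡ ⟦ does (sum a ≟ k) ⟧ (withRowSizes k a) d) ⟩
  ∑[ a ← J ^ᴸ n ] (⟦ does (sum a ≟ k) ⟧ * ∑ (withRowSizes k a) d) ∎
  where
  open ≡-Reasoning
  J = applyUpTo suc k

-- The number of k-sets with a given support of ℓ rows; `innerSum` is its inclusion-exclusion
-- formula.
crossing : ℕ → ℕ → ℕ
crossing k ℓ = ∑[ A ← nonempty k ^ᴸ ℓ ] hasSize A

crossing≡ : ∀ k ℓ → crossing k ℓ ≡ ∑[ a ← applyUpTo suc k ^ᴸ ℓ ] (⟦ does (sum a ≟ k) ⟧ * ∑[ _ ← withRowSizes k a ] 1)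
crossing≡ k ℓ = trans (∑-cong (nonempty k ^ᴸ ℓ) (λ A → sym (*-identityʳ (hasSize A)))) (∑-hasSize k ℓ (λ _ → 1))

hitting-≤ : ∀ k l (d : Matrix (suc l) k → ℕ) →
            (∀ w → 1 ≤ ∑[ t ← allFin (suc l) ] d (class t w)) →
            crossing k (suc l) ≤ suc l * ∑[ A ← nonempty k ^ᴸ suc l ] (hasSize A * d A)
hitting-≤ k l d hit = subst₂ _≤_ (sym (crossing≡ k (suc l))) (cong (suc l *_) (sym (∑-hasSize k (suc l) d)))
                                 (Averaging-≤.total d hit (applyUpTo suc k))

hitting-≡ : ∀ k l (d : Matrix (suc l) k → ℕ) →
            (∀ w → 1 ≡ ∑[ t ← allFin (suc l) ] d (class t w)) →
            crossing k (suc l) ≡ suc l * ∑[ A ← nonempty k ^ᴸ suc l ] (hasSize A * d A)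
hitting-≡ k l d hit = trans (crossing≡ k (suc l)) (trans (Averaging-≡.total d hit (applyUpTo suc k))
                        (cong (suc l *_) (sym (∑-hasSize k (suc l) d))))

-- Counting by size

∑-bits-++ : ∀ m n h → ∑ (bits (m + n)) h ≡ ∑[ u ← bits m ] ∑[ v ← bits n ] h (u Vec.++ v)
∑-bits-++ zero    n h = sym (+-identityʳ _)
∑-bits-++ (suc m) n h = begin
  ∑ (bits (suc m + n)) h
    ≡⟨ ∑-bits-suc (m + n) h ⟩
  ∑ (bits (m + n)) (h ∘ (true ∷_)) + ∑ (bits (m + n)) (h ∘ (false ∷_))
    ≡⟨ cong₂ _+_ (∑-bits-++ m n _) (∑-bits-++ m n _) ⟩
  ∑[ u ← bits m ] ∑[ v ← bits n ] h (true ∷ u Vec.++ v) + ∑[ u ← bits m ] ∑[ v ← bits n ] h (false ∷ u Vec.++ v)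
    ≡⟨ ∑-bits-suc m _ ⟨
  ∑[ u ← bits (suc m) ] ∑[ v ← bits n ] h (u Vec.++ v) ∎
  where open ≡-Reasoning

∑-bits-concat : ∀ m k h → ∑ (bits k ^ᴸ m) (h ∘ Vec.concat) ≡ ∑ (bits (m * k)) h
∑-bits-concat zero    k h = refl
∑-bits-concat (suc m) k h = begin
  ∑ (bits k ^ᴸ suc m) (h ∘ Vec.concat)                          ≡⟨ ∑-^ᴸ m (bits k) _ ⟩
  ∑[ r ← bits k ] ∑[ A ← bits k ^ᴸ m ] h (r Vec.++ Vec.concat A) ≡⟨ ∑-cong (bits k) (λ r → ∑-bits-concat m k _) ⟩
  ∑[ r ← bits k ] ∑[ v ← bits (m * k) ] h (r Vec.++ v)          ≡⟨ ∑-bits-++ k (m * k) h ⟨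
  ∑ (bits (k + m * k)) h                                        ∎
  where open ≡-Reasoning

size-concat : ∀ {m k} (A : Matrix m k) → ∣ Vec.concat A ∣ ≡ size A
size-concat []      = refl
size-concat (r ∷ A) = trans (∣++∣ r (Vec.concat A)) (cong (∣ r ∣ +_) (size-concat A))

∑-bits-choose : ∀ n t → ∑[ v ← bits n ] ⟦ does (∣ v ∣ ≟ t) ⟧ ≡ n C t
∑-bits-choose zero    zero    = refl
∑-bits-choose zero    (suc t) = refl
∑-bits-choose (suc n) zero    = trans (∑-bits-suc n (λ v → ⟦ does (∣ v ∣ ≟ 0) ⟧)) (cong₂ _+_ (∑-0 (bits n)) (∑-bits-choose n 0))
∑-bits-choose (suc n) (suc t) = trans (∑-bits-suc n (λ v → ⟦ does (∣ v ∣ ≟ suc t) ⟧))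
  (trans (cong₂ _+_ (∑-bits-choose n t) (∑-bits-choose n (suc t))) (nCk+nC[k+1]≡[n+1]C[k+1] n t))

-- Every k-set of the m × k grid has one support, and C(m,ℓ) supports have size ℓ. Inverting this
-- identity will evaluate `innerSum`.
binomialSum-crossing : ∀ k m → binomialSum (crossing k) m ≡ (m * k) C k
binomialSum-crossing k m = begin
  binomialSum (crossing k) m
    ≡⟨ ∑-bits-size m (crossing k) ⟨
  ∑[ S ← bits m ] ∑ (nonempty k ^ᴸ ∣ S ∣) hasSize
    ≡⟨ ∑-cong (bits m) (λ S → ∑-cong (nonempty k ^ᴸ ∣ S ∣) (λ A → cong (λ s → ⟦ does (s ≟ k) ⟧) (sym (size-expand S A)))) ⟩
  ∑[ S ← bits m ] ∑ (nonempty k ^ᴸ ∣ S ∣) (hasSize ∘ expand S)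
    ≡⟨ ∑-bySupport m k hasSize ⟨
  ∑ (bits k ^ᴸ m) hasSize
    ≡⟨ ∑-cong (bits k ^ᴸ m) (λ A → cong (λ s → ⟦ does (s ≟ k) ⟧) (sym (size-concat A))) ⟩
  ∑ (bits k ^ᴸ m) ((λ v → ⟦ does (∣ v ∣ ≟ k) ⟧) ∘ Vec.concat)
    ≡⟨ ∑-bits-concat m k _ ⟩
  ∑[ v ← bits (m * k) ] ⟦ does (∣ v ∣ ≟ k) ⟧
    ≡⟨ ∑-bits-choose (m * k) k ⟩
  (m * k) C k ∎
  where open ≡-Reasoning

crossing-1 : ∀ k → crossing (suc k) 1 ≡ 1
crossing-1 k = begin
  -- The added term belongs to the empty support, which carries no set of size `suc k`.
  crossing (suc k) 1                         ≡⟨ +-identityʳ _ ⟨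
  binomialSum (crossing (suc k)) 1           ≡⟨ binomialSum-crossing (suc k) 1 ⟩
  (1 * suc k) C suc k                        ≡⟨ cong (_C suc k) (*-identityˡ (suc k)) ⟩
  suc k C suc k                              ≡⟨ nCn≡1 (suc k) ⟩
  1 ∎
  where open ≡-Reasoning

-- The extremal family

-- The recursion skips empty rows and decides at the first row that is met; `size A ≟ 0` there says
-- that no later row is met.
allowed : ∀ {m k} → Matrix m (suc k) → Bool
allowed []      = true
allowed (r ∷ A) = if does (∣ r ∣ ≟ 0) then allowed A else (not (head r) ∨ does (size A ≟ 0))

allowed-empty : ∀ {m k} r (A : Matrix m (suc k)) → ∣ r ∣ ≡ 0 → allowed (r ∷ A) ≡ allowed A
allowed-empty r A r≡0 rewrite dec-true (∣ r ∣ ≟ 0) r≡0 = refl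

allowed-nonempty : ∀ {m k} r (A : Matrix m (suc k)) → ∣ r ∣ ≢ 0 →
                   allowed (r ∷ A) ≡ not (head r) ∨ does (size A ≟ 0)
allowed-nonempty r A r≢0 rewrite dec-false (∣ r ∣ ≟ 0) r≢0 = refl

allowed-expand : ∀ {m k} (S : Vec Bool m) (A : Matrix ∣ S ∣ (suc k)) → allowed (expand S A) ≡ allowed A
allowed-expand []          []      = refl
allowed-expand (true ∷ S)  (r ∷ A) rewrite allowed-expand S A | size-expand S A = refl
allowed-expand {k = k} (false ∷ S) A rewrite ∣replicate-false∣ k = allowed-expand S A

-- The number of edges of the extremal hypergraph with a given support of ℓ rows. The uniformity is
-- `suc k`, so that rows have a head. For ℓ ≥ 2 this will be the coefficient b, and for ℓ = 1 the
-- coefficient 1 of m in `f`.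
admitted : ℕ → ℕ → ℕ
admitted k ℓ = ∑[ A ← nonempty (suc k) ^ᴸ ℓ ] (hasSize A * ⟦ allowed A ⟧)

binomialSum-admitted : ∀ k m → ∑[ A ← bits (suc k) ^ᴸ m ] (hasSize A * ⟦ allowed A ⟧) ≡ binomialSum (admitted k) m
binomialSum-admitted k m = begin
  ∑[ A ← bits (suc k) ^ᴸ m ] (hasSize A * ⟦ allowed A ⟧)
    ≡⟨ ∑-bySupport m (suc k) _ ⟩
  ∑[ S ← bits m ] ∑[ A ← nonempty (suc k) ^ᴸ ∣ S ∣ ] (hasSize (expand S A) * ⟦ allowed (expand S A) ⟧)
    ≡⟨ ∑-cong (bits m) (λ S → ∑-cong (nonempty (suc k) ^ᴸ ∣ S ∣) (λ A →
         cong₂ (λ s a → ⟦ does (s ≟ suc k) ⟧ * ⟦ a ⟧) (size-expand S A) (allowed-expand S A))) ⟩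
  ∑[ S ← bits m ] admitted k ∣ S ∣
    ≡⟨ ∑-bits-size m (admitted k) ⟩
  binomialSum (admitted k) m ∎
  where open ≡-Reasoning

admitted-1 : ∀ k → admitted k 1 ≡ 1
admitted-1 k = trans (∑-cong (nonempty (suc k) ^ᴸ 1) all-allowed) (crossing-1 k)
  where
  all-allowed : ∀ (A : Matrix 1 (suc k)) → hasSize A * ⟦ allowed A ⟧ ≡ hasSize A
  all-allowed (r ∷ []) with does (∣ r ∣ ≟ 0)
  ... | true  = *-identityʳ _
  ... | false rewrite Bool.∨-zeroʳ (not (head r)) = *-identityʳ _

admitted≤crossing : ∀ k ℓ → admitted k ℓ ≤ crossing (suc k) ℓ
admitted≤crossing k ℓ = ∑-mono (nonempty (suc k) ^ᴸ ℓ) (λ A → ≤-trans (*-monoʳ-≤ (hasSize A) (⟦⟧≤1 (allowed A))) (≤-reflexive (*-identityʳ (hasSize A))))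
  where
  ⟦⟧≤1 : ∀ c → ⟦ c ⟧ ≤ 1
  ⟦⟧≤1 true  = ≤-refl
  ⟦⟧≤1 false = z≤n

crossing-large : ∀ k ℓ → k < ℓ → crossing k ℓ ≡ 0
crossing-large k ℓ k<ℓ = trans (∑-cong-∈ (nonempty k ^ᴸ ℓ) (λ {A} A∈ →
    cong ⟦_⟧ (dec-false (size A ≟ k) (λ eq → <⇒≱ k<ℓ (≤-trans (All-nonempty⇒≤size (∈-nonempty^⁻ k ℓ A∈)) (≤-reflexive eq))))))
  (∑-0 (nonempty k ^ᴸ ℓ))

admitted-large : ∀ k ℓ → suc k < ℓ → admitted k ℓ ≡ 0
admitted-large k ℓ k<ℓ = n≤0⇒n≡0 (≤-trans (admitted≤crossing k ℓ) (≤-reflexive (crossing-large (suc k) ℓ k<ℓ)))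

∑-is : ∀ n (s : Fin n) → ∑[ t ← allFin n ] ⟦ is t s ⟧ ≡ 1
∑-is (suc n) s = trans (cong (⟦ is zero s ⟧ +_) (trans (cong (λ L → ∑ L (λ t → ⟦ is t s ⟧)) (sym (List.map-tabulate id suc))) (∑-map suc (allFin n) (λ t → ⟦ is t s ⟧)))) (go s)
  where
  go : ∀ (s : Fin (suc n)) → ⟦ is zero s ⟧ + ∑[ t ← allFin n ] ⟦ is (suc t) s ⟧ ≡ 1
  go zero    = cong suc (∑-0 (allFin n))
  go (suc s) = ∑-is n s

-- The support has `suc l` rows. From two rows on, these are exactly the omitted sets.
excluded : ℕ → ℕ → ℕ
excluded k l = ∑[ A ← nonempty (suc k) ^ᴸ suc l ] (hasSize A * ⟦ head (head A) ⟧)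

-- In any colouring the first cell of the first row has one colour, so exactly one class contains it
-- and the averaging is an equality.
crossing≡excluded : ∀ k l → crossing (suc k) (suc l) ≡ suc l * excluded k l
crossing≡excluded k l = hitting-≡ (suc k) l (λ A → ⟦ head (head A) ⟧)
  (λ { w@((s ∷ _) ∷ _) → sym (∑-is (suc l) s) })

-- With at least two rows, all of them met, the first row decides and a later row is non-empty, so
-- `allowed` reduces to the head being absent.
admitted+excluded : ∀ k l → admitted k (suc (suc l)) + excluded k (suc l) ≡ crossing (suc k) (suc (suc l))
admitted+excluded k l = trans (sym (∑-+ L _ _)) (∑-cong-∈ L (λ {A} A∈ → split A (∈-nonempty^⁻ (suc k) (suc (suc l)) A∈)))
  where
  L = nonempty (suc k) ^ᴸ suc (suc l)
  ⟦⟧-not : ∀ c → ⟦ not c ⟧ + ⟦ c ⟧ ≡ 1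
  ⟦⟧-not true  = refl
  ⟦⟧-not false = refl
  split : ∀ (A : Matrix (suc (suc l)) (suc k)) → VecAll.All Nonempty A → hasSize A * ⟦ allowed A ⟧ + hasSize A * ⟦ head (head A) ⟧ ≡ hasSize A
  split A@(r ∷ r′ ∷ B) (p ∷ p′ ∷ _) = begin
    hasSize A * ⟦ allowed A ⟧ + hasSize A * ⟦ head r ⟧
      ≡⟨ *-distribˡ-+ (hasSize A) ⟦ allowed A ⟧ ⟦ head r ⟧ ⟨
    hasSize A * (⟦ allowed A ⟧ + ⟦ head r ⟧)
      ≡⟨ cong (λ c → hasSize A * (⟦ c ⟧ + ⟦ head r ⟧)) allowed≡ ⟩
    hasSize A * (⟦ not (head r) ⟧ + ⟦ head r ⟧)
      ≡⟨ cong (hasSize A *_) (⟦⟧-not (head r)) ⟩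
    hasSize A * 1
      ≡⟨ *-identityʳ (hasSize A) ⟩
    hasSize A ∎
    where
    open ≡-Reasoning
    allowed≡ : allowed A ≡ not (head r)
    allowed≡ = trans (allowed-nonempty r (r′ ∷ B) p)
      (trans (cong (not (head r) ∨_) (dec-false (size (r′ ∷ B) ≟ 0) (λ eq → p′ (m+n≡0⇒m≡0 ∣ r′ ∣ eq)))) (Bool.∨-identityʳ _))

-- The upper bound for a fixed support

∑≡0 : ∀ {X : Set} (xs : List X) {h : X → ℕ} → ∑ xs h ≡ 0 → ∀ {x} → x ∈ xs → h x ≡ 0
∑≡0 (x ∷ xs) {h} eq (here refl) = m+n≡0⇒m≡0 (h x) eq
∑≡0 (x ∷ xs) {h} eq (there x∈)  = ∑≡0 xs (m+n≡0⇒n≡0 (h x) eq) x∈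

allNonempty? : ∀ {n k} (A : Matrix n k) → Dec (VecAll.All Nonempty A)
allNonempty? = VecAll.all? (λ r → ¬? (∣ r ∣ ≟ 0))

indicator≤hasSize : ∀ {ℓ k} (g : Matrix ℓ k → Bool) → (∀ A → g A ≡ true → size A ≡ k) → ∀ A → ⟦ g A ⟧ ≤ hasSize A
indicator≤hasSize {k = k} g uniform A with g A in eq
... | false = z≤n
... | true  = ≤-reflexive (cong ⟦_⟧ (sym (dec-true (size A ≟ k) (uniform A eq))))

-- No set has empty support, and only the full row is supported on one row. From two rows on, every
-- frame contains a non-edge, so by averaging the non-edges are at least as many as the excluded
-- sets; `excluded` is added to both sides instead of being subtracted.
supported-≤ : ∀ k ℓ (g : Matrix ℓ (suc k) → Bool) →
  (∀ A → g A ≡ true → size A ≡ suc k) →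
  (2 ≤ ℓ → ∀ (w : Vec (Vec (Fin ℓ) (suc k)) ℓ) → ¬ (∀ t → g (class t w) ≡ true × VecAll.All Nonempty (class t w))) →
  ∑[ A ← nonempty (suc k) ^ᴸ ℓ ] ⟦ g A ⟧ ≤ admitted k ℓ
supported-≤ k zero g uniform _ = +-monoˡ-≤ 0 (≤-trans (indicator≤hasSize g uniform []) z≤n)
supported-≤ k (suc zero) g uniform _ = ≤-trans (∑-mono (nonempty (suc k) ^ᴸ 1) (indicator≤hasSize g uniform))
  (≤-reflexive (trans (crossing-1 k) (sym (admitted-1 k))))
supported-≤ k (suc (suc l)) g uniform noFrame = +-cancelʳ-≤ (excluded k (suc l)) _ _ (begin
  ∑ L (⟦_⟧ ∘ g) + excluded k (suc l)   ≤⟨ +-monoʳ-≤ (∑ L (⟦_⟧ ∘ g)) excluded≤ ⟩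
  ∑ L (⟦_⟧ ∘ g) + ∑[ A ← L ] (hasSize A * d A) ≡⟨ ∑-+ L _ _ ⟨
  ∑[ A ← L ] (⟦ g A ⟧ + hasSize A * d A) ≤⟨ ∑-mono-∈ L (λ {A} A∈ → pointwise A (∈-nonempty^⁻ (suc k) ℓ′ A∈)) ⟩
  crossing (suc k) ℓ′                  ≡⟨ admitted+excluded k l ⟨
  admitted k ℓ′ + excluded k (suc l)   ∎)
  where
  open ≤-Reasoning
  ℓ′ = suc (suc l)
  L = nonempty (suc k) ^ᴸ ℓ′
  -- Matrices with an empty row are marked too, so that an arbitrary colouring has a marked class
  -- unless it is a frame of edges. They do not occur in `L`, where `d` marks just the non-edges.
  d : Matrix ℓ′ (suc k) → ℕ
  d A = ⟦ not (g A ∧ does (allNonempty? A)) ⟧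
  d≡0 : ∀ A → d A ≡ 0 → g A ≡ true × VecAll.All Nonempty A
  d≡0 A eq with g A | allNonempty? A
  ... | true | yes ps = refl , ps
  hit : ∀ w → 1 ≤ ∑[ t ← allFin ℓ′ ] d (class t w)
  hit w with ∑ (allFin ℓ′) (λ t → d (class t w)) in eq
  ... | suc _ = s≤s z≤n
  ... | zero  = contradiction (λ t → d≡0 (class t w) (∑≡0 (allFin ℓ′) {λ t → d (class t w)} eq (∈-allFin t))) (noFrame (s≤s (s≤s z≤n)) w)
  excluded≤ : excluded k (suc l) ≤ ∑[ A ← L ] (hasSize A * d A)
  excluded≤ = *-cancelˡ-≤ ℓ′ (subst (_≤ ℓ′ * ∑[ A ← L ] (hasSize A * d A)) (crossing≡excluded k (suc l)) (hitting-≤ (suc k) (suc l) d hit))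
  pointwise : ∀ A → VecAll.All Nonempty A → ⟦ g A ⟧ + hasSize A * d A ≤ hasSize A
  pointwise A ps with allNonempty? A | g A | indicator≤hasSize g uniform A
  ... | no ¬ps | _     | _  = contradiction ps ¬ps
  ... | yes _  | true  | le = ≤-trans (≤-reflexive (cong suc (*-zeroʳ (hasSize A)))) le
  ... | yes _  | false | _  = ≤-reflexive (*-identityʳ (hasSize A))

-- Sums over lists without repetitions

∑-remove : ∀ {X : Set} (as : List X) {bs x} h → ∑ (as ++ x ∷ bs) h ≡ h x + ∑ (as ++ bs) h
∑-remove as {bs} {x} h = begin
  ∑ (as ++ x ∷ bs) h       ≡⟨ ∑-++ as (x ∷ bs) h ⟩
  ∑ as h + (h x + ∑ bs h)  ≡⟨ x∙yz≈y∙xz (∑ as h) (h x) (∑ bs h) ⟩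
  h x + (∑ as h + ∑ bs h)  ≡⟨ cong (h x +_) (∑-++ as bs h) ⟨
  h x + ∑ (as ++ bs) h     ∎
  where
  open ≡-Reasoning

∑-⊆ : ∀ {X : Set} (xs ys : List X) → Unique xs → (∀ {x} → x ∈ xs → x ∈ ys) → ∀ h → ∑ xs h ≤ ∑ ys h
∑-⊆ []       ys _          _  h = z≤n
∑-⊆ (x ∷ xs) ys (x∉ ∷ uniq) ⊆ys h with ∈-∃++ (⊆ys (here refl))
... | as , bs , refl = subst (h x + ∑ xs h ≤_) (sym (∑-remove as h)) (+-monoʳ-≤ (h x) (∑-⊆ xs (as ++ bs) uniq rest h))
  where
  rest : ∀ {z} → z ∈ xs → z ∈ as ++ bs
  rest z∈ with ∈-++⁻ as (⊆ys (there z∈))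
  ... | inj₁ z∈as         = ∈-++⁺ˡ z∈as
  ... | inj₂ (here refl)  = contradiction refl (All.lookup x∉ z∈)
  ... | inj₂ (there z∈bs) = ∈-++⁺ʳ as z∈bs

∑-allFin-suc : ∀ n h → ∑ (allFin (suc n)) h ≡ h zero + ∑ (allFin n) (h ∘ suc)
∑-allFin-suc n h = cong (h zero +_) (trans (cong (λ L → ∑ L h) (sym (List.map-tabulate id suc))) (∑-map suc (allFin n) h))

∣∣≡∑ : ∀ {n} (v : Vec Bool n) → ∣ v ∣ ≡ ∑[ i ← allFin n ] ⟦ lookup v i ⟧
∣∣≡∑ []          = refl
∣∣≡∑ {suc n} (true ∷ v)  = trans (cong suc (∣∣≡∑ v)) (sym (∑-allFin-suc n (λ i → ⟦ lookup (true ∷ v) i ⟧)))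
∣∣≡∑ {suc n} (false ∷ v) = trans (∣∣≡∑ v) (sym (∑-allFin-suc n (λ i → ⟦ lookup (false ∷ v) i ⟧)))

size≡∑ : ∀ {m k} (A : Matrix m k) → size A ≡ ∑[ i ← allFin m ] ∑[ j ← allFin k ] ⟦ lookup (lookup A i) j ⟧
size≡∑ []      = refl
size≡∑ {suc m} {k} (r ∷ A) = trans (cong₂ _+_ (∣∣≡∑ r) (size≡∑ A))
  (sym (∑-allFin-suc m (λ i → ∑[ j ← allFin k ] ⟦ lookup (lookup (r ∷ A) i) j ⟧)))

-- Layouts

lookup-ext : ∀ {X : Set} {n} (u v : Vec X n) → (∀ i → lookup u i ≡ lookup v i) → u ≡ v
lookup-ext u v eq = trans (sym (Vec.tabulate∘lookup u)) (trans (Vec.tabulate-cong eq) (Vec.tabulate∘lookup v))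

is-refl : ∀ {n} (t : Fin n) → is t t ≡ true
is-refl t = dec-true (t Fin.≟ t) refl

is-≢ : ∀ {n} {t s : Fin n} → s ≢ t → is t s ≡ false
is-≢ {t = t} {s} = dec-false (s Fin.≟ t)

is⇒≡ : ∀ {n} {t s : Fin n} → is t s ≡ true → s ≡ t
is⇒≡ {t = t} {s} eq with s Fin.≟ t | eq
... | yes s≡t | _  = s≡t
... | no  _   | ()

-- A bijection between the vertices and the cells of the grid. It is abstract because two are used:
-- one whose rows are the edges of a given matching, and the product layout of the extremal
-- hypergraph.
record Layout (m k n : ℕ) : Set where
  field
    at         : Fin m → Fin k → Fin n
    row        : Fin n → Fin m
    col        : Fin n → Fin k
    at-row-col : ∀ v → at (row v) (col v) ≡ v
    row-at     : ∀ i j → row (at i j) ≡ i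
    col-at     : ∀ i j → col (at i j) ≡ j

  decode : Matrix m k → Subset n
  decode A = tabulate (λ v → lookup (lookup A (row v)) (col v))

  encode : Subset n → Matrix m k
  encode e = tabulate (λ i → tabulate (λ j → lookup e (at i j)))

  block : Fin m → Subset n
  block i = tabulate (λ v → is i (row v))

  lookup-decode : ∀ A i j → lookup (decode A) (at i j) ≡ lookup (lookup A i) j
  lookup-decode A i j = trans (Vec.lookup∘tabulate _ (at i j))
    (cong₂ (λ i j → lookup (lookup A i) j) (row-at i j) (col-at i j))

  lookup-encode : ∀ e i j → lookup (lookup (encode e) i) j ≡ lookup e (at i j)
  lookup-encode e i j = trans (cong (λ r → lookup r j) (Vec.lookup∘tabulate _ i)) (Vec.lookup∘tabulate _ j)

  decode-encode : ∀ e → decode (encode e) ≡ e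
  decode-encode e = lookup-ext _ e (λ v → trans (Vec.lookup∘tabulate _ v)
    (trans (lookup-encode e (row v) (col v)) (cong (lookup e) (at-row-col v))))

  encode-decode : ∀ A → encode (decode A) ≡ A
  encode-decode A = lookup-ext _ A (λ i → lookup-ext _ (lookup A i) (λ j →
    trans (lookup-encode (decode A) i j) (lookup-decode A i j)))

  decode-injective : ∀ {A B} → decode A ≡ decode B → A ≡ B
  decode-injective eq = trans (sym (encode-decode _)) (trans (cong encode eq) (encode-decode _))

  at-injective : ∀ {i j i′ j′} → at i j ≡ at i′ j′ → i ≡ i′ × j ≡ j′
  at-injective {i} {j} {i′} {j′} eq =
    trans (sym (row-at i j)) (trans (cong row eq) (row-at i′ j′)) ,
    trans (sym (col-at i j)) (trans (cong col eq) (col-at i′ j′))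

  -- The list of vertices and the list of cells are free of repetitions and contain each other,
  -- which gives the two inequalities.
  ∑-vertices : ∀ h → ∑ (allFin n) h ≡ ∑[ i ← allFin m ] ∑[ j ← allFin k ] h (at i j)
  ∑-vertices h = trans (≤-antisym
      (∑-⊆ (allFin n) cells (Unique.allFin⁺ n) (λ {v} _ → subst (_∈ cells) (at-row-col v) (∈-cartesianProductWith⁺ at (∈-allFin (row v)) (∈-allFin (col v)))) h)
      (∑-⊆ cells (allFin n) (Unique.cartesianProductWith⁺ at at-injective (Unique.allFin⁺ m) (Unique.allFin⁺ k)) (λ {v} _ → ∈-allFin v) h))
    (∑-cartesian at (allFin m) (allFin k) h)
    where cells = cartesianProductWith at (allFin m) (allFin k)

  ∣decode∣ : ∀ A → ∣ decode A ∣ ≡ size A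
  ∣decode∣ A = begin
    ∣ decode A ∣                                                ≡⟨ ∣∣≡∑ (decode A) ⟩
    ∑[ v ← allFin n ] ⟦ lookup (decode A) v ⟧                   ≡⟨ ∑-vertices (λ v → ⟦ lookup (decode A) v ⟧) ⟩
    ∑[ i ← allFin m ] ∑[ j ← allFin k ] ⟦ lookup (decode A) (at i j) ⟧
      ≡⟨ ∑-cong (allFin m) (λ i → ∑-cong (allFin k) (λ j → cong ⟦_⟧ (lookup-decode A i j))) ⟩
    ∑[ i ← allFin m ] ∑[ j ← allFin k ] ⟦ lookup (lookup A i) j ⟧ ≡⟨ size≡∑ A ⟨
    size A                                                      ∎
    where open ≡-Reasoning

  -- Needed because the number of edges in a perfect matching is not given and has to be recovered
  -- from the number of vertices.
  rows≡ : m * k ≡ n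
  rows≡ = ↔⇒≡ (mk↔ₛ′ to from to-from from-to)
    where
    to : Fin (m * k) → Fin n
    to x = at (proj₁ (remQuot {m} k x)) (proj₂ (remQuot {m} k x))
    from : Fin n → Fin (m * k)
    from v = combine (row v) (col v)
    to-from : ∀ v → to (from v) ≡ v
    to-from v = trans (cong (λ p → at (proj₁ p) (proj₂ p)) (Fin.remQuot-combine (row v) (col v))) (at-row-col v)
    from-to : ∀ x → from (to x) ≡ x
    from-to x = trans (cong₂ combine (row-at _ _) (col-at _ _)) (Fin.combine-remQuot {m} k x)

-- Matchings

∈ₛ⇒lookup : ∀ {n} {e : Subset n} {v} → v ∈ₛ e → lookup e v ≡ true
∈ₛ⇒lookup = Vec.[]=⇒lookup

lookup⇒∈ₛ : ∀ {n} {e : Subset n} {v} → lookup e v ≡ true → v ∈ₛ e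
lookup⇒∈ₛ {e = e} {v} = Vec.lookup⇒[]= v e

∣∣≢0⇒inhabited : ∀ {n} (v : Vec Bool n) → ∣ v ∣ ≢ 0 → ∃[ j ] lookup v j ≡ true
∣∣≢0⇒inhabited []          ≢0 = contradiction refl ≢0
∣∣≢0⇒inhabited (true ∷ v)  ≢0 = zero , refl
∣∣≢0⇒inhabited (false ∷ v) ≢0 with ∣∣≢0⇒inhabited v ≢0
... | j , eq = suc j , eq

lookup⇒∣∣≢0 : ∀ {n} (v : Vec Bool n) j → lookup v j ≡ true → ∣ v ∣ ≢ 0
lookup⇒∣∣≢0 (true ∷ v)  zero    eq ()
lookup⇒∣∣≢0 (true ∷ v)  (suc j) eq ()
lookup⇒∣∣≢0 (false ∷ v) (suc j) eq = lookup⇒∣∣≢0 v j eq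

colourClass : ∀ {n q} → (Fin n → Fin q) → Fin q → Subset n
colourClass χ c = tabulate (λ v → is c (χ v))

∈-colourClass : ∀ {n q} (χ : Fin n → Fin q) c v → v ∈ₛ colourClass χ c → χ v ≡ c
∈-colourClass χ c v v∈ = is⇒≡ (trans (sym (Vec.lookup∘tabulate _ v)) (∈ₛ⇒lookup v∈))

∈-ownClass : ∀ {n q} (χ : Fin n → Fin q) v → v ∈ₛ colourClass χ (χ v)
∈-ownClass χ v = lookup⇒∈ₛ (trans (Vec.lookup∘tabulate _ v) (is-refl (χ v)))

module _ {k n} (H : Hypergraph (suc k) n) where

  edge-inhabited : ∀ {e} → e ∈ edges H → ∃[ v ] v ∈ₛ e
  edge-inhabited {e} e∈ with ∣∣≢0⇒inhabited e (λ eq → contradiction (trans (sym eq) (All.lookup (uniform H) e∈)) λ ())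
  ... | v , eq = v , lookup⇒∈ₛ eq

  -- Classes of a colouring are disjoint and cover all vertices automatically, so new matchings are
  -- built by recolouring and only membership in H has to be checked.
  colouring⇒matching : ∀ {q} (χ : Fin n → Fin q) → (∀ c → colourClass χ c ∈ edges H) →
                       IsPerfectMatching H (List.tabulate (colourClass χ))
  colouring⇒matching χ χ∈ = record
    { sub    = All.tabulate⁺ χ∈
    ; noRep  = AllPairs.tabulate⁺ different
    ; disj   = AllPairs.tabulate⁺ (λ {c} {c′} c≢c′ v v∈ v∈′ →
                 c≢c′ (trans (sym (∈-colourClass χ c v v∈)) (∈-colourClass χ c′ v v∈′)))
    ; covers = λ v → Any.tabulate⁺ (χ v) (∈-ownClass χ v)
    }
    where
    -- Disjoint classes could coincide only if empty, which edges of positive size are not.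
    different : ∀ {c c′} → c ≢ c′ → colourClass χ c ≢ colourClass χ c′
    different {c} {c′} c≢c′ eq with edge-inhabited (χ∈ c)
    ... | v , v∈ = c≢c′ (trans (sym (∈-colourClass χ c v v∈)) (∈-colourClass χ c′ v (subst (v ∈ₛ_) eq v∈)))

disjoint-lookup : ∀ {n} (M : List (Subset n)) → AllPairs Disjoint M → ∀ {v} i i′ →
                  v ∈ₛ List.lookup M i → v ∈ₛ List.lookup M i′ → i ≡ i′
disjoint-lookup (e ∷ M) (_ ∷ _)    zero    zero     _  _   = refl
disjoint-lookup (e ∷ M) (d ∷ _) {v} zero    (suc i′) v∈ v∈′ =
  contradiction (All.lookup d (∈-lookup i′) v v∈ v∈′) λ ()
disjoint-lookup (e ∷ M) (d ∷ _) {v} (suc i) zero     v∈ v∈′ =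
  contradiction (All.lookup d (∈-lookup i) v v∈′ v∈) λ ()
disjoint-lookup (e ∷ M) (_ ∷ ds)   (suc i) (suc i′) v∈ v∈′ = cong suc (disjoint-lookup M ds i i′ v∈ v∈′)

disjoint⇒≡ : ∀ {n} {M : List (Subset n)} → AllPairs Disjoint M → ∀ {e e′ v} →
             e ∈ M → e′ ∈ M → v ∈ₛ e → v ∈ₛ e′ → e ≡ e′
disjoint⇒≡ {M = M} ds {e} {e′} {v} e∈ e′∈ v∈ v∈′ =
  trans (Any.lookup-index e∈) (trans (cong (List.lookup M) same) (sym (Any.lookup-index e′∈)))
  where
  same : Any.index e∈ ≡ Any.index e′∈
  same = disjoint-lookup M ds (Any.index e∈) (Any.index e′∈)
    (subst (v ∈ₛ_) (Any.lookup-index e∈) v∈) (subst (v ∈ₛ_) (Any.lookup-index e′∈) v∈′)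

∈-∏⁺ : ∀ {X : Set} n (L : List X) → (∀ x → x ∈ L) → ∀ (v : Vec X n) → v ∈ L ^ᴸ n
∈-∏⁺ zero    L x∈ []      = here refl
∈-∏⁺ (suc n) L x∈ (x ∷ v) = ∈-cartesianProductWith⁺ _∷_ (x∈ x) (∈-∏⁺ n L x∈ v)

∈-matrices : ∀ {m k} (A : Matrix m k) → A ∈ bits k ^ᴸ m
∈-matrices {m} {k} = ∈-∏⁺ m (bits k) (∈-∏⁺ k _ (λ { true → here refl ; false → there (here refl) }))

-- The upper bound

-- The increasing enumeration of the true entries. It serves both for the rows of a support and for
-- the vertices of an edge.
position : ∀ {m} (S : Vec Bool m) → Fin ∣ S ∣ → Fin m
position (true ∷ S)  zero    = zero
position (true ∷ S)  (suc r) = suc (position S r)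
position (false ∷ S) r       = suc (position S r)

position-injective : ∀ {m} (S : Vec Bool m) {r r′} → position S r ≡ position S r′ → r ≡ r′
position-injective (true ∷ S)  {zero}  {zero}   _  = refl
position-injective (true ∷ S)  {suc r} {suc r′} eq = cong suc (position-injective S (Fin.suc-injective eq))
position-injective (false ∷ S)                  eq = position-injective S (Fin.suc-injective eq)

lookup-expand : ∀ {m k} (S : Vec Bool m) (A : Matrix ∣ S ∣ k) r → lookup (expand S A) (position S r) ≡ lookup A r
lookup-expand (true ∷ S)  (x ∷ A) zero    = refl
lookup-expand (true ∷ S)  (x ∷ A) (suc r) = lookup-expand S A r
lookup-expand (false ∷ S) A       r       = lookup-expand S A r

-- A view of a row relative to a support: matching on `inside` exhibits its index among the
-- supported rows, while `outside` carries the fact that expanded matrices vanish there.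
data Membership {m} (S : Vec Bool m) : Fin m → Set where
  inside  : ∀ r → Membership S (position S r)
  outside : ∀ {i} → (∀ r → position S r ≢ i) →
            (∀ {k} (A : Matrix ∣ S ∣ k) → lookup (expand S A) i ≡ zeros k) → Membership S i

membership : ∀ {m} (S : Vec Bool m) i → Membership S i
membership (true ∷ S)  zero    = inside zero
membership (false ∷ S) zero    = outside (λ _ ()) (λ _ → refl)
membership (true ∷ S)  (suc i) with membership S i
... | inside r       = inside (suc r)
... | outside ≢i out = outside (λ { (suc r) eq → ≢i r (Fin.suc-injective eq) }) (λ { (_ ∷ A) → out A })
membership (false ∷ S) (suc i) with membership S i
... | inside r       = inside r
... | outside ≢i out = outside (λ r eq → ≢i r (Fin.suc-injective eq)) (λ A → out A)

module _ {m k n} (Λ : Layout m (suc k) n) (H : Hypergraph (suc k) n) where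
  open Layout Λ

  -- The class of colour position S t is the class t of the frame w, and colours outside S give back blocks.
  module _ (S : Vec Bool m) (w : Vec (Vec (Fin ∣ S ∣) (suc k)) ∣ S ∣) where

    cellColour : ∀ {i} → Membership S i → Fin (suc k) → Fin m
    cellColour (inside r)          j = position S (lookup (lookup w r) j)
    cellColour (outside {i} _ _) _ = i

    colour : Fin n → Fin m
    colour v = cellColour (membership S (row v)) (col v)

    colourClass-inside : ∀ t → colourClass colour (position S t) ≡ decode (expand S (class t w))
    colourClass-inside t = lookup-ext _ _ (λ v → trans (Vec.lookup∘tabulate _ v)
      (trans (cell (membership S (row v)) (col v)) (sym (Vec.lookup∘tabulate _ v))))
      where
      is-position : ∀ s → is (position S t) (position S s) ≡ is t s
      is-position s with s Fin.≟ t
      ... | yes refl = is-refl (position S s)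
      ... | no  s≢t  = is-≢ (s≢t ∘ position-injective S)
      cell : ∀ {i} (p : Membership S i) j →
             is (position S t) (cellColour p j) ≡ lookup (lookup (expand S (class t w)) i) j
      cell (inside r) j = begin
        is (position S t) (position S (lookup (lookup w r) j)) ≡⟨ is-position (lookup (lookup w r) j) ⟩
        is t (lookup (lookup w r) j)                        ≡⟨ Vec.lookup-map j (is t) (lookup w r) ⟨
        lookup (map (is t) (lookup w r)) j                  ≡⟨ cong (λ u → lookup u j) (Vec.lookup-map r (map (is t)) w) ⟨
        lookup (lookup (class t w) r) j                     ≡⟨ cong (λ u → lookup u j) (lookup-expand S (class t w) r) ⟨
        lookup (lookup (expand S (class t w)) (position S r)) j ∎
        where open ≡-Reasoning
      -- A row outside S keeps its own colour, which is no position of S, and the expanded class has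
      -- no entry in it.
      cell (outside {i} ≢i out) j = trans (is-≢ (≢i t ∘ sym))
        (trans (sym (Vec.lookup-replicate j false)) (cong (λ u → lookup u j) (sym (out (class t w)))))

    colourClass-outside : ∀ {c} → (∀ r → position S r ≢ c) → colourClass colour c ≡ block c
    colourClass-outside {c} ≢c = Vec.tabulate-cong (λ v → cell (membership S (row v)) (col v))
      where
      cell : ∀ {i} (p : Membership S i) j → is c (cellColour p j) ≡ is c i
      -- Rows of S receive only colours that are positions of S, so c does not occur there.
      cell (inside r)    j = trans (is-≢ (≢c _)) (sym (is-≢ (≢c r)))
      cell (outside _ _) j = refl

  module _ (blocks∈ : ∀ i → block i ∈ edges H)
           (unique : ∀ M → IsPerfectMatching H M → ∀ {e} → e ∈ M → ∃[ i ] e ≡ block i) where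

    -- Exchanging the rows of S for the frame gives a perfect matching, so by uniqueness the class
    -- of r is a block. But this class meets every row of S, hence all these rows are the row of
    -- that block.
    frame⇒one-row : ∀ S (w : Vec (Vec (Fin ∣ S ∣) (suc k)) ∣ S ∣) →
      (∀ t → decode (expand S (class t w)) ∈ edges H × VecAll.All Nonempty (class t w)) →
      ∀ (r r′ : Fin ∣ S ∣) → r ≡ r′
    frame⇒one-row S w frame r r′ = position-injective S (trans (in-block r) (sym (in-block r′)))
      where
      open ≡-Reasoning
      classes∈ : ∀ c → colourClass (colour S w) c ∈ edges H
      classes∈ c with membership S c
      ... | inside t     = subst (_∈ edges H) (sym (colourClass-inside S w t)) (proj₁ (frame t))
      ... | outside ≢c _ = subst (_∈ edges H) (sym (colourClass-outside S w ≢c)) (blocks∈ c)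
      A = class r w
      a-block : ∃[ i ] colourClass (colour S w) (position S r) ≡ block i
      a-block = unique (List.tabulate (colourClass (colour S w))) (colouring⇒matching H (colour S w) classes∈)
                       (∈-tabulate⁺ (position S r))
      i = proj₁ a-block
      in-block : ∀ r′ → position S r′ ≡ i
      in-block r′ with ∣∣≢0⇒inhabited (lookup A r′) (VecAll.lookup⁺ (proj₂ (frame r)) r′)
      ... | j , eq = trans (sym (row-at (position S r′) j)) (is⇒≡ (begin
        is i (row (at (position S r′) j))                     ≡⟨ Vec.lookup∘tabulate _ (at (position S r′) j) ⟨
        lookup (block i) (at (position S r′) j)               ≡⟨ cong (λ e → lookup e (at (position S r′) j)) (trans (sym (proj₂ a-block)) (colourClass-inside S w r)) ⟩
        lookup (decode (expand S A)) (at (position S r′) j)   ≡⟨ lookup-decode (expand S A) (position S r′) j ⟩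
        lookup (lookup (expand S A) (position S r′)) j        ≡⟨ cong (λ u → lookup u j) (lookup-expand S A r′) ⟩
        lookup (lookup A r′) j                                ≡⟨ eq ⟩
        true ∎))

    -- Edges are counted as matrices through `decode`, sorted by support and bounded on each support
    -- separately; a frame of edges on two or more rows would contradict `frame⇒one-row`.
    numEdges-≤ : numEdges H ≤ binomialSum (admitted k) m
    numEdges-≤ = begin
      numEdges H                                    ≡⟨ length≡∑ (edges H) (λ {e} e∈ → dec-true (e ∈? edges H) e∈) ⟩
      ∑[ e ← edges H ] ⟦ does (e ∈? edges H) ⟧       ≤⟨ ∑-⊆ (edges H) (List.map decode matrices) (distinct H) (λ {e} _ → decoded e) _ ⟩
      ∑[ e ← List.map decode matrices ] ⟦ does (e ∈? edges H) ⟧ ≡⟨ ∑-map decode matrices _ ⟩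
      ∑[ A ← matrices ] ⟦ g A ⟧                      ≡⟨ ∑-bySupport m (suc k) (⟦_⟧ ∘ g) ⟩
      ∑[ S ← bits m ] ∑[ A ← nonempty (suc k) ^ᴸ ∣ S ∣ ] ⟦ g (expand S A) ⟧ ≤⟨ ∑-mono (bits m) (λ S → supported-≤ k ∣ S ∣ (g ∘ expand S) (sizes S) (frameless S)) ⟩
      ∑[ S ← bits m ] admitted k ∣ S ∣               ≡⟨ ∑-bits-size m (admitted k) ⟩
      binomialSum (admitted k) m                    ∎
      where
      open ≤-Reasoning
      open DecMembership (Vec.≡-dec Bool._≟_) using (_∈?_)
      matrices = bits (suc k) ^ᴸ m
      g : Matrix m (suc k) → Bool
      g A = does (decode A ∈? edges H)
      g⇒∈ : ∀ A → g A ≡ true → decode A ∈ edges H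
      g⇒∈ A eq with decode A ∈? edges H | eq
      ... | yes e∈ | _ = e∈
      length≡∑ : ∀ es {h : Subset n → Bool} → (∀ {e} → e ∈ es → h e ≡ true) → length es ≡ ∑[ e ← es ] ⟦ h e ⟧
      length≡∑ []       _  = refl
      length≡∑ (e ∷ es) h≡ rewrite h≡ (here refl) = cong suc (length≡∑ es (h≡ ∘ there))
      decoded : ∀ e → e ∈ List.map decode matrices
      decoded e = subst (_∈ List.map decode matrices) (decode-encode e) (∈-map⁺ decode (∈-matrices (encode e)))
      sizes : ∀ S (A : Matrix ∣ S ∣ (suc k)) → g (expand S A) ≡ true → size A ≡ suc k
      sizes S A eq = trans (sym (size-expand S A)) (trans (sym (∣decode∣ (expand S A))) (All.lookup (uniform H) (g⇒∈ (expand S A) eq)))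
      frameless : ∀ S → 2 ≤ ∣ S ∣ → ∀ (w : Vec (Vec (Fin ∣ S ∣) (suc k)) ∣ S ∣) →
                  ¬ (∀ t → g (expand S (class t w)) ≡ true × VecAll.All Nonempty (class t w))
      frameless S 2≤ℓ w frame = distinct-rows 2≤ℓ (frame⇒one-row S w (λ t → g⇒∈ (expand S (class t w)) (proj₁ (frame t)) , proj₂ (frame t)))
        where
        distinct-rows : ∀ {ℓ} → 2 ≤ ℓ → ¬ (∀ (r r′ : Fin ℓ) → r ≡ r′)
        distinct-rows (s≤s (s≤s _)) all-equal with all-equal zero (suc zero)
        ... | ()

-- The layout given by a perfect matching

lookup-position : ∀ {n} (e : Subset n) j → lookup e (position e j) ≡ true
lookup-position (true ∷ e)  zero    = refl
lookup-position (true ∷ e)  (suc j) = lookup-position e j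
lookup-position (false ∷ e) j       = lookup-position e j

rank : ∀ {n} (e : Subset n) v → lookup e v ≡ true → ∃[ j ] position e j ≡ v
rank (true ∷ e)  zero    _  = zero , refl
rank (true ∷ e)  (suc v) eq with rank e v eq
... | j , refl = suc j , refl
rank (false ∷ e) (suc v) eq with rank e v eq
... | j , refl = j , refl

module FromMatching {k n} (H : Hypergraph k n) (M : List (Subset n)) (pm : IsPerfectMatching H M) where
  open IsPerfectMatching pm

  edge : Fin (length M) → Subset n
  edge = List.lookup M

  ∣edge∣ : ∀ i → ∣ edge i ∣ ≡ k
  ∣edge∣ i = All.lookup (uniform H) (All.lookup sub (∈-lookup i))

  row′ : Fin n → Fin (length M)
  row′ v = Any.index (covers v)

  v∈row : ∀ v → lookup (edge (row′ v)) v ≡ true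
  v∈row v = ∈ₛ⇒lookup (Any.lookup-index (covers v))

  layout : Layout (length M) k n
  layout = record
    { at         = at′
    ; row        = row′
    ; col        = col′
    ; at-row-col = at-row-col′
    ; row-at     = row-at′
    -- Both columns name the same vertex in row i, and `at′ i` is injective.
    ; col-at     = λ i j → at-injective′ i (trans (cong (λ i′ → at′ i′ (col′ (at′ i j))) (sym (row-at′ i j))) (at-row-col′ (at′ i j)))
    }
    where
    at′ : Fin (length M) → Fin k → Fin n
    at′ i j = position (edge i) (Fin.cast (sym (∣edge∣ i)) j)
    col′ : Fin n → Fin k
    col′ v = Fin.cast (∣edge∣ (row′ v)) (proj₁ (rank (edge (row′ v)) v (v∈row v)))
    at-row-col′ : ∀ v → at′ (row′ v) (col′ v) ≡ v
    at-row-col′ v = trans (cong (position (edge (row′ v))) (Fin.cast-involutive (sym (∣edge∣ (row′ v))) (∣edge∣ (row′ v)) _))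
                          (proj₂ (rank (edge (row′ v)) v (v∈row v)))
    row-at′ : ∀ i j → row′ (at′ i j) ≡ i
    row-at′ i j = disjoint-lookup M disj (row′ (at′ i j)) i (lookup⇒∈ₛ (v∈row (at′ i j))) (lookup⇒∈ₛ (lookup-position (edge i) _))
    at-injective′ : ∀ i {j j′} → at′ i j ≡ at′ i j′ → j ≡ j′
    at-injective′ i {j} {j′} eq = trans (sym (uncast j)) (trans (cong (Fin.cast (∣edge∣ i)) (position-injective (edge i) eq)) (uncast j′))
      where
      uncast : ∀ j → Fin.cast (∣edge∣ i) (Fin.cast (sym (∣edge∣ i)) j) ≡ j
      uncast j = Fin.cast-involutive (∣edge∣ i) (sym (∣edge∣ i)) j

  open Layout layout

  edge≡block : ∀ i → edge i ≡ block i
  edge≡block i = lookup-ext _ _ (λ v → trans (same v) (sym (Vec.lookup∘tabulate _ v)))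
    where
    same : ∀ v → lookup (edge i) v ≡ is i (row v)
    same v with row v Fin.≟ i
    ... | yes refl = v∈row v
    ... | no  ≢i with lookup (edge i) v in eq
    ...   | false = refl
    ...   | true  = contradiction (disjoint-lookup M disj (row v) i (lookup⇒∈ₛ (v∈row v)) (lookup⇒∈ₛ eq)) ≢i

  block∈ : ∀ i → block i ∈ edges H
  block∈ i = subst (_∈ edges H) (edge≡block i) (All.lookup sub (∈-lookup i))

  ∈⇒block : ∀ {e} → e ∈ M → ∃[ i ] e ≡ block i
  ∈⇒block e∈ = Any.index e∈ , trans (Any.lookup-index e∈) (edge≡block (Any.index e∈))

upper-bound : ∀ k m (H : Hypergraph (suc k) (suc k * m)) → HasUniquePerfectMatching H →
              numEdges H ≤ binomialSum (admitted k) m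
upper-bound k m H (M , pm , unique) = subst (λ m → numEdges H ≤ binomialSum (admitted k) m) length≡m
  (numEdges-≤ layout H block∈ (λ M′ pm′ {e} e∈ → ∈⇒block (Equivalence.to (unique M′ pm′ e) e∈)))
  where
  open FromMatching H M pm
  length≡m : length M ≡ m
  length≡m = *-cancelʳ-≡ (length M) m (suc k) (trans (Layout.rows≡ layout) (*-comm (suc k) m))

-- The extremal hypergraph

∏-unique : ∀ {X : Set} n {L : List X} → Unique L → Unique (L ^ᴸ n)
∏-unique zero    u = [] ∷ []
∏-unique (suc n) u = Unique.cartesianProductWith⁺ _∷_ Vec.∷-injective u (∏-unique n u)

matrices-unique : ∀ m k → Unique (bits k ^ᴸ m)
matrices-unique m k = ∏-unique m (∏-unique k (((λ ()) ∷ []) ∷ [] ∷ []))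

∑-filter : ∀ {X : Set} (p : X → Bool) xs → length (filter (λ x → p x Bool.≟ true) xs) ≡ ∑[ x ← xs ] ⟦ p x ⟧
∑-filter p []       = refl
∑-filter p (x ∷ xs) with p x
... | true  = cong suc (∑-filter p xs)
... | false = ∑-filter p xs

does-true : ∀ {P : Set} (p? : Dec P) → does p? ≡ true → P
does-true (yes p) _ = p

-- If row i is the first row met, then containing its head is permitted only when no other row is
-- met. This dichotomy drives the induction that forces the blocks into every perfect matching.
allowed-head : ∀ {m k} (A : Matrix m (suc k)) → allowed A ≡ true → ∀ i → head (lookup A i) ≡ true →
               (∃[ i′ ] toℕ i′ < toℕ i × Nonempty (lookup A i′)) ⊎ size A ≡ ∣ lookup A i ∣
allowed-head (r ∷ A) ok i h with ∣ r ∣ ≟ 0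
allowed-head (r ∷ A) ok (suc i) h | no r≢0 = inj₁ (zero , s≤s z≤n , r≢0)
allowed-head (r ∷ A) ok zero h | no r≢0 = inj₂ (trans (cong (∣ r ∣ +_) size≡0) (+-identityʳ ∣ r ∣))
  where
  size≡0 : size A ≡ 0
  size≡0 = does-true (size A ≟ 0) (trans (cong (λ c → not c ∨ does (size A ≟ 0)) (sym h)) (trans (sym (allowed-nonempty r A r≢0)) ok))
allowed-head (r@(_ ∷ _) ∷ A) ok zero h | yes r≡0 = contradiction r≡0 (lookup⇒∣∣≢0 r zero h)
allowed-head (r ∷ A) ok (suc i) h | yes r≡0 with allowed-head A (trans (sym (allowed-empty r A r≡0)) ok) i h
... | inj₁ (i′ , i′<i , ne) = inj₁ (suc i′ , s≤s i′<i , ne)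
... | inj₂ size≡            = inj₂ (trans (cong (_+ size A) r≡0) size≡)

unitMatrix : ∀ {m} k → Fin m → Matrix m k
unitMatrix k c = tabulate (λ i → replicate k (is c i))

size-zeros : ∀ m k → size {m} {k} (tabulate (λ _ → replicate k false)) ≡ 0
size-zeros zero    k = refl
size-zeros (suc m) k = cong₂ _+_ (∣replicate-false∣ k) (size-zeros m k)

size-unitMatrix : ∀ {m} k (c : Fin m) → size (unitMatrix k c) ≡ k
size-unitMatrix {suc m} k zero    = trans (cong₂ _+_ (∣replicate-true∣ k) (size-zeros m k)) (+-identityʳ k)
size-unitMatrix {suc m} k (suc c) = cong₂ _+_ (∣replicate-false∣ k) (size-unitMatrix k c)

allowed-unitMatrix : ∀ {m} k (c : Fin m) → allowed (unitMatrix (suc k) c) ≡ true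
allowed-unitMatrix {suc m} k zero    rewrite size-zeros m (suc k) = refl
allowed-unitMatrix {suc m} k (suc c) rewrite ∣replicate-false∣ k = allowed-unitMatrix k c

lookup≤size : ∀ {m k} (A : Matrix m k) i → ∣ lookup A i ∣ ≤ size A
lookup≤size (r ∷ A) zero    = m≤m+n ∣ r ∣ (size A)
lookup≤size (r ∷ A) (suc i) = ≤-trans (lookup≤size A i) (m≤n+m (size A) ∣ r ∣)

two-rows≤size : ∀ {m k} (A : Matrix m k) {i i′} → i ≢ i′ → ∣ lookup A i ∣ + ∣ lookup A i′ ∣ ≤ size A
two-rows≤size (r ∷ A) {zero}  {zero}   i≢ = contradiction refl i≢
two-rows≤size (r ∷ A) {zero}  {suc i′} _  = +-monoʳ-≤ ∣ r ∣ (lookup≤size A i′)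
two-rows≤size (r ∷ A) {suc i} {zero}   _  = ≤-trans (≤-reflexive (+-comm ∣ lookup A i ∣ ∣ r ∣)) (+-monoʳ-≤ ∣ r ∣ (lookup≤size A i))
two-rows≤size (r ∷ A) {suc i} {suc i′} i≢ = ≤-trans (two-rows≤size A (i≢ ∘ cong suc)) (m≤n+m (size A) ∣ r ∣)

full-row⇒unitMatrix : ∀ {m k} (A : Matrix m k) i → size A ≡ k → size A ≡ ∣ lookup A i ∣ → A ≡ unitMatrix k i
full-row⇒unitMatrix {m} {k} A i size≡k size≡row =
  lookup-ext _ _ (λ i′ → trans (rowOf i′) (sym (Vec.lookup∘tabulate _ i′)))
  where
  ∣p∣≡0 : ∀ {n} (p : Vec Bool n) → ∣ p ∣ ≡ 0 → p ≡ replicate n false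
  ∣p∣≡0 []          _  = refl
  ∣p∣≡0 (false ∷ p) eq = cong (false ∷_) (∣p∣≡0 p eq)
  rowOf : ∀ i′ → lookup A i′ ≡ replicate k (is i i′)
  rowOf i′ with i′ Fin.≟ i
  ... | yes refl = ∣p∣≡n⇒p≡⊤ (trans (sym size≡row) size≡k)
  ... | no  i′≢i = ∣p∣≡0 (lookup A i′) (n≤0⇒n≡0 (+-cancelʳ-≤ ∣ lookup A i ∣ _ _
                     (≤-trans (two-rows≤size A i′≢i) (≤-reflexive size≡row))))

module Extremal (k m : ℕ) where

  layout : Layout m (suc k) (suc k * m)
  layout = record
    -- The column comes first because the number of vertices is `suc k * m`, with m as the inner
    -- factor.
    { at         = λ i j → combine j i
    ; row        = λ v → proj₂ (remQuot {suc k} m v)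
    ; col        = λ v → proj₁ (remQuot {suc k} m v)
    ; at-row-col = Fin.combine-remQuot {suc k} m
    ; row-at     = λ i j → cong proj₂ (Fin.remQuot-combine j i)
    ; col-at     = λ i j → cong proj₁ (Fin.remQuot-combine j i)
    }

  open Layout layout

  isEdge : Matrix m (suc k) → Bool
  isEdge A = does (size A ≟ suc k) ∧ allowed A

  isEdge⁻ : ∀ A → isEdge A ≡ true → size A ≡ suc k × allowed A ≡ true
  isEdge⁻ A eq = does-true (size A ≟ suc k) (Bool.∧-conicalˡ _ _ eq) , Bool.∧-conicalʳ (does (size A ≟ suc k)) _ eq

  edgeMatrices : List (Matrix m (suc k))
  edgeMatrices = filter (λ A → isEdge A Bool.≟ true) (bits (suc k) ^ᴸ m)

  edge⁻ : ∀ {e} → e ∈ List.map decode edgeMatrices → ∃[ A ] e ≡ decode A × size A ≡ suc k × allowed A ≡ true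
  edge⁻ e∈ with ∈-map⁻ decode e∈
  ... | A , A∈ , refl = A , refl , isEdge⁻ A (proj₂ (∈-filter⁻ (λ A → isEdge A Bool.≟ true) {xs = bits (suc k) ^ᴸ m} A∈))

  H : Hypergraph (suc k) (suc k * m)
  H = record
    { edges    = List.map decode edgeMatrices
    ; distinct = Unique.map⁺ decode-injective (Unique.filter⁺ (λ A → isEdge A Bool.≟ true) (matrices-unique m (suc k)))
    ; uniform  = All.tabulate λ {e} e∈ → let A , e≡ , size≡ , _ = edge⁻ e∈ in trans (cong ∣_∣ e≡) (trans (∣decode∣ A) size≡)
    }

  numEdges≡ : numEdges H ≡ binomialSum (admitted k) m
  numEdges≡ = begin
    numEdges H                              ≡⟨ List.length-map decode edgeMatrices ⟩
    length edgeMatrices                     ≡⟨ ∑-filter isEdge (bits (suc k) ^ᴸ m) ⟩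
    ∑[ A ← bits (suc k) ^ᴸ m ] ⟦ isEdge A ⟧ ≡⟨ ∑-cong (bits (suc k) ^ᴸ m) (λ A → ⟦∧⟧ (does (size A ≟ suc k)) (allowed A)) ⟩
    ∑[ A ← bits (suc k) ^ᴸ m ] (hasSize A * ⟦ allowed A ⟧) ≡⟨ binomialSum-admitted k m ⟩
    binomialSum (admitted k) m              ∎
    where
    open ≡-Reasoning
    ⟦∧⟧ : ∀ c d → ⟦ c ∧ d ⟧ ≡ ⟦ c ⟧ * ⟦ d ⟧
    ⟦∧⟧ true  d = sym (*-identityˡ ⟦ d ⟧)
    ⟦∧⟧ false d = refl

  decode-unitMatrix : ∀ i → decode (unitMatrix (suc k) i) ≡ block i
  decode-unitMatrix i = Vec.tabulate-cong (λ v →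
    trans (cong (λ r → lookup r (col v)) (Vec.lookup∘tabulate _ (row v))) (Vec.lookup-replicate (col v) (is i (row v))))

  block∈ : ∀ i → block i ∈ edges H
  block∈ i = subst (_∈ edges H) (decode-unitMatrix i)
    (∈-map⁺ decode (∈-filter⁺ (λ A → isEdge A Bool.≟ true) (∈-matrices (unitMatrix (suc k) i))
      (cong₂ _∧_ (dec-true (size (unitMatrix (suc k) i) ≟ suc k) (size-unitMatrix (suc k) i)) (allowed-unitMatrix k i))))

  module _ (M : List (Subset (suc k * m))) (pm : IsPerfectMatching H M) where
    open IsPerfectMatching pm

    -- The edge covering the head of row i can only reach an earlier row, whose block is already in M, or be block i.
    block∈M : ∀ n i → toℕ i < n → block i ∈ M
    block∈M (suc n) i (s≤s i≤n) with find (covers (at i zero))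
    ... | e , e∈M , v∈e with edge⁻ (All.lookup sub e∈M)
    ...   | A , refl , size≡ , ok with allowed-head A ok i head≡
      where
      head≡ : head (lookup A i) ≡ true
      head≡ = trans (head≡lookup (lookup A i)) (trans (sym (lookup-decode A i zero)) (∈ₛ⇒lookup v∈e))
        where
        head≡lookup : ∀ (r : Vec Bool (suc k)) → head r ≡ lookup r zero
        head≡lookup (_ ∷ _) = refl
    ...     | inj₂ size≡row = subst (_∈ M) (trans (cong decode (full-row⇒unitMatrix A i size≡ size≡row)) (decode-unitMatrix i)) e∈M
    ...     | inj₁ (i′ , i′<i , ne) with ∣∣≢0⇒inhabited (lookup A i′) ne
    ...       | j , eq = contradiction (cong toℕ i≡i′) (<⇒≢ i′<i ∘ sym)
      where
      in-block : at i′ j ∈ₛ block i′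
      in-block = lookup⇒∈ₛ (trans (Vec.lookup∘tabulate _ (at i′ j)) (trans (cong (is i′) (row-at i′ j)) (is-refl i′)))
      e≡block : decode A ≡ block i′
      e≡block = disjoint⇒≡ disj e∈M (block∈M n i′ (<-≤-trans i′<i i≤n)) (lookup⇒∈ₛ (trans (lookup-decode A i′ j) eq)) in-block
      i≡i′ : i ≡ i′
      i≡i′ = trans (sym (row-at i zero)) (∈-colourClass row i′ (at i zero) (subst (at i zero ∈ₛ_) e≡block v∈e))

    -- An edge of M has a vertex, which the block of its row, already known to lie in M, covers too;
    -- disjointness makes them equal.
    ∈⇒block : ∀ {e} → e ∈ M → e ∈ List.tabulate block
    ∈⇒block {e} e∈ with edge-inhabited H (All.lookup sub e∈)
    ... | v , v∈ = subst (_∈ List.tabulate block)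
      (disjoint⇒≡ disj (block∈M (suc (toℕ (row v))) (row v) ≤-refl) e∈ (∈-ownClass row v) v∈) (∈-tabulate⁺ (row v))

    block⇒∈ : ∀ {e} → e ∈ List.tabulate block → e ∈ M
    block⇒∈ e∈ with ∈-tabulate⁻ e∈
    ... | i , refl = block∈M (suc (toℕ i)) i ≤-refl

  uniqueMatching : HasUniquePerfectMatching H
  uniqueMatching = List.tabulate block , colouring⇒matching H row block∈ , λ M pm e → mk⇔ (∈⇒block M pm) (block⇒∈ M pm)

open import Data.Integer as ℤ using (ℤ; +_)
import Data.Integer.Properties as ℤ
import Data.Integer.Tactic.RingSolver as ℤ-Solver
open import Data.Rational as ℚ using (ℚ; mkℚ; _/_) renaming (_≤_ to _≤ℚ_)
import Data.Rational.Properties as ℚ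
open import Data.Rational.Unnormalised using (mkℚᵘ; *≡*)

-- Inclusion–exclusion as iterated finite differences

sumℤ-cong : ∀ n {g h : ℕ → ℤ} → (∀ i → i < n → g i ≡ h i) → sumℤ n g ≡ sumℤ n h
sumℤ-cong zero    eq = refl
sumℤ-cong (suc n) eq = cong₂ ℤ._+_ (sumℤ-cong n (λ i i<n → eq i (m<n⇒m<1+n i<n))) (eq n ≤-refl)

sumℤ-minus : ∀ n (g h : ℕ → ℤ) → sumℤ n (λ i → g i ℤ.- h i) ≡ sumℤ n g ℤ.- sumℤ n h
sumℤ-minus zero    g h = refl
sumℤ-minus (suc n) g h rewrite sumℤ-minus n g h = arith (sumℤ n g) (sumℤ n h) (g n) (h n)
  where
  arith : ∀ a b c d → (a ℤ.- b) ℤ.+ (c ℤ.- d) ≡ (a ℤ.+ c) ℤ.- (b ℤ.+ d)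
  arith = ℤ-Solver.solve-∀

sumℤ-first : ∀ n g → sumℤ (suc n) g ≡ g 0 ℤ.+ sumℤ n (g ∘ suc)
sumℤ-first zero    g = ℤ.+-comm (+ 0) (g 0)
sumℤ-first (suc n) g = trans (cong (ℤ._+ g (suc n)) (sumℤ-first n g)) (ℤ.+-assoc (g 0) _ _)

sign : ℕ → ℤ
sign i = (ℤ.- ℤ.1ℤ) ℤ.^ i

-- The q-th forward difference of x at 0, in its closed alternating form.
Δ : ℕ → (ℕ → ℤ) → ℤ
Δ q x = sumℤ (suc q) (λ i → sign i ℤ.* (+ (q C i) ℤ.* x (q ∸ i)))

Δ-suc : ∀ q x → Δ (suc q) x ≡ Δ q (λ n → x (suc n) ℤ.- x n)
Δ-suc q x = begin
  Δ (suc q) x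
    ≡⟨ sumℤ-first (suc q) _ ⟩
  sign 0 ℤ.* (+ (suc q C 0) ℤ.* x (suc q)) ℤ.+ sumℤ (suc q) (λ i → sign (suc i) ℤ.* (+ (suc q C suc i) ℤ.* x (q ∸ i)))
    ≡⟨ cong₂ (λ c s → sign 0 ℤ.* (+ c ℤ.* x (suc q)) ℤ.+ s) {suc q C 0} refl
         (trans (sumℤ-cong (suc q) (λ i _ → pascal i)) (sumℤ-minus (suc q) (g ∘ suc) _)) ⟩
  g 0 ℤ.+ (sumℤ (suc q) (g ∘ suc) ℤ.- Δ q x)
    ≡⟨ ℤ.+-assoc (g 0) _ _ ⟨
  g 0 ℤ.+ sumℤ (suc q) (g ∘ suc) ℤ.- Δ q x
    ≡⟨ cong (ℤ._- Δ q x) (sumℤ-first (suc q) g) ⟨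
  sumℤ (suc q) g ℤ.+ g (suc q) ℤ.- Δ q x
    ≡⟨ cong (λ c → sumℤ (suc q) g ℤ.+ c ℤ.- Δ q x) last≡0 ⟩
  sumℤ (suc q) g ℤ.+ + 0 ℤ.- Δ q x
    ≡⟨ cong (ℤ._- Δ q x) (ℤ.+-identityʳ (sumℤ (suc q) g)) ⟩
  sumℤ (suc q) g ℤ.- Δ q x
    ≡⟨ sumℤ-minus (suc q) g _ ⟨
  sumℤ (suc q) (λ i → g i ℤ.- sign i ℤ.* (+ (q C i) ℤ.* x (q ∸ i)))
    ≡⟨ sumℤ-cong (suc q) merge ⟩
  Δ q (λ n → x (suc n) ℤ.- x n) ∎
  where
  open ≡-Reasoning
  g : ℕ → ℤ
  g i = sign i ℤ.* (+ (q C i) ℤ.* x (suc q ∸ i))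
  -- C(q, q+1) vanishes, so the sum from Pascal's rule may lose its last term and match the range of
  -- `Δ q`.
  last≡0 : g (suc q) ≡ + 0
  last≡0 rewrite k>n⇒nCk≡0 {q} {suc q} ≤-refl | ℤ.*-zeroˡ (x (q ∸ q)) = ℤ.*-zeroʳ (sign (suc q))
  arith : ∀ s a b y → (ℤ.- ℤ.1ℤ ℤ.* s) ℤ.* ((a ℤ.+ b) ℤ.* y) ≡ (ℤ.- ℤ.1ℤ ℤ.* s) ℤ.* (b ℤ.* y) ℤ.- s ℤ.* (a ℤ.* y)
  arith = ℤ-Solver.solve-∀
  pascal : ∀ i → sign (suc i) ℤ.* (+ (suc q C suc i) ℤ.* x (q ∸ i)) ≡ g (suc i) ℤ.- sign i ℤ.* (+ (q C i) ℤ.* x (q ∸ i))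
  pascal i rewrite sym (nCk+nC[k+1]≡[n+1]C[k+1] q i) = arith (sign i) (+ (q C i)) (+ (q C suc i)) (x (q ∸ i))
  arith′ : ∀ s c y z → s ℤ.* (c ℤ.* y) ℤ.- s ℤ.* (c ℤ.* z) ≡ s ℤ.* (c ℤ.* (y ℤ.- z))
  arith′ = ℤ-Solver.solve-∀
  merge : ∀ i → i < suc q → g i ℤ.- sign i ℤ.* (+ (q C i) ℤ.* x (q ∸ i)) ≡ sign i ℤ.* (+ (q C i) ℤ.* (x (suc (q ∸ i)) ℤ.- x (q ∸ i)))
  merge i (s≤s i≤q) rewrite +-∸-assoc 1 i≤q = arith′ (sign i) (+ (q C i)) (x (suc (q ∸ i))) (x (q ∸ i))

-- Binomial inversion: one difference in m replaces G by its shift, so q of them leave the value of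
-- `binomialSum` at 0 for the q-fold shift, which is G(q).
Δ-binomialSum : ∀ q G → Δ q (λ n → + binomialSum G n) ≡ + G q
Δ-binomialSum zero    G = trans (ℤ.+-identityˡ _) (trans (ℤ.*-identityˡ _) (ℤ.*-identityˡ (+ G 0)))
Δ-binomialSum (suc q) G = begin
  Δ (suc q) (λ n → + binomialSum G n)
    ≡⟨ Δ-suc q (λ n → + binomialSum G n) ⟩
  Δ q (λ n → + binomialSum G (suc n) ℤ.- + binomialSum G n)
    ≡⟨ sumℤ-cong (suc q) (λ i _ → cong (λ y → sign i ℤ.* (+ (q C i) ℤ.* y)) (arith (+ binomialSum (G ∘ suc) (q ∸ i)) (+ binomialSum G (q ∸ i)))) ⟩
  Δ q (λ n → + binomialSum (G ∘ suc) n)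
    ≡⟨ Δ-binomialSum q (G ∘ suc) ⟩
  + G (suc q) ∎
  where
  open ≡-Reasoning
  arith : ∀ a b → a ℤ.+ b ℤ.- b ≡ a
  arith = ℤ-Solver.solve-∀

-- By `binomialSum-crossing` the binomial coefficients in `innerSum` are values of a binomial
-- transform, and the alternating sum inverts it. The missing term i = ℓ would count sets of size
-- `suc k` in an empty grid.
innerSum≡crossing : ∀ k ℓ → innerSum (suc k) ℓ ≡ + crossing (suc k) ℓ
innerSum≡crossing k ℓ = begin
  innerSum (suc k) ℓ
    ≡⟨ sumℤ-cong ℓ (λ i _ → cong (sign i ℤ.*_) (term i)) ⟩
  sumℤ ℓ g
    ≡⟨ ℤ.+-identityʳ _ ⟨
  sumℤ ℓ g ℤ.+ + 0
    ≡⟨ cong (λ c → sumℤ ℓ g ℤ.+ c) last≡0 ⟨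
  Δ ℓ (λ n → + binomialSum (crossing (suc k)) n)
    ≡⟨ Δ-binomialSum ℓ (crossing (suc k)) ⟩
  + crossing (suc k) ℓ ∎
  where
  open ≡-Reasoning
  g : ℕ → ℤ
  g i = sign i ℤ.* (+ (ℓ C i) ℤ.* + binomialSum (crossing (suc k)) (ℓ ∸ i))
  last≡0 : g ℓ ≡ + 0
  last≡0 = trans (cong (λ n → sign ℓ ℤ.* (+ (ℓ C ℓ) ℤ.* + binomialSum (crossing (suc k)) n)) (n∸n≡0 ℓ))
           (trans (cong (sign ℓ ℤ.*_) (ℤ.*-zeroʳ (+ (ℓ C ℓ)))) (ℤ.*-zeroʳ (sign ℓ)))
  term : ∀ i → + ((ℓ C i) * ((suc k * (ℓ ∸ i)) C suc k)) ≡ + (ℓ C i) ℤ.* + binomialSum (crossing (suc k)) (ℓ ∸ i)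
  term i rewrite binomialSum-crossing (suc k) (ℓ ∸ i) | *-comm (ℓ ∸ i) (suc k) = ℤ.pos-* (ℓ C i) _

-- Rational arithmetic

fromℕ : ℕ → ℚ
fromℕ n = + n / 1

-- The operation `_/_` cancels a gcd and does not compute for a variable numerator; with the normal
-- form exhibited, sums, products and order reduce to integers.
fromℕ≡ : ∀ n → fromℕ n ≡ mkℚ (+ n) 0 (coprime-sym (1-coprimeTo n))
fromℕ≡ n = ℚ.↥p/↧p≡p (mkℚ (+ n) 0 (coprime-sym (1-coprimeTo n)))

fromℕ-+ : ∀ m n → fromℕ (m + n) ≡ fromℕ m ℚ.+ fromℕ n
fromℕ-+ m n = sym (trans (cong₂ ℚ._+_ (fromℕ≡ m) (fromℕ≡ n))
  (cong (_/ 1) (cong₂ ℤ._+_ (ℤ.*-identityʳ (+ m)) (ℤ.*-identityʳ (+ n)))))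

fromℕ-* : ∀ m n → fromℕ (m * n) ≡ fromℕ m ℚ.* fromℕ n
fromℕ-* m n = sym (trans (cong₂ ℚ._*_ (fromℕ≡ m) (fromℕ≡ n))
  (cong (_/ 1) (sym (ℤ.pos-* m n))))

fromℕ-mono : ∀ {m n} → m ≤ n → fromℕ m ℚ.≤ fromℕ n
fromℕ-mono {m} {n} m≤n = subst₂ ℚ._≤_ (sym (fromℕ≡ m)) (sym (fromℕ≡ n))
  (ℚ.*≤* (ℤ.*-monoʳ-≤-nonNeg (+ 1) (ℤ.+≤+ m≤n)))

∑-upTo-last : ∀ n h → ∑ (upTo (suc n)) h ≡ ∑ (upTo n) h + h n
∑-upTo-last n h = begin
  ∑ (upTo (suc n)) h                ≡⟨ cong (λ L → ∑ L h) (List.upTo-∷ʳ n) ⟨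
  ∑ (upTo n List.++ n ∷ []) h       ≡⟨ ∑-++ (upTo n) (n ∷ []) h ⟩
  ∑ (upTo n) h + (h n + 0)          ≡⟨ cong (λ y → ∑ (upTo n) h + y) (+-identityʳ (h n)) ⟩
  ∑ (upTo n) h + h n                ∎
  where open ≡-Reasoning

sumℚ-fromℕ : ∀ n (g : ℕ → ℚ) h → (∀ i → g i ≡ fromℕ (h i)) → sumℚ n g ≡ fromℕ (∑ (upTo n) h)
sumℚ-fromℕ zero    g h eq = refl
sumℚ-fromℕ (suc n) g h eq = begin
  sumℚ n g ℚ.+ g n                     ≡⟨ cong₂ ℚ._+_ (sumℚ-fromℕ n g h eq) (eq n) ⟩
  fromℕ (∑ (upTo n) h) ℚ.+ fromℕ (h n) ≡⟨ fromℕ-+ (∑ (upTo n) h) (h n) ⟨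
  fromℕ (∑ (upTo n) h + h n)           ≡⟨ cong fromℕ (∑-upTo-last n h) ⟨
  fromℕ (∑ (upTo (suc n)) h)           ∎
  where open ≡-Reasoning

-- The coefficients and `f` as counts

b≡admitted : ∀ k l → b (suc k) (suc (suc l)) ≡ fromℕ (admitted k (suc (suc l)))
b≡admitted k l = begin
  (+ suc l ℤ.* innerSum (suc k) ℓ) / ℓ  ≡⟨ cong (λ s → (+ suc l ℤ.* s) / ℓ) (innerSum≡crossing k ℓ) ⟩
  (+ suc l ℤ.* + N) / ℓ                 ≡⟨ cong (_/ ℓ) (trans (sym (ℤ.pos-* (suc l) N)) (trans (cong +_ count) (ℤ.pos-* ℓ P))) ⟩
  (+ ℓ ℤ.* + P) / ℓ                     ≡⟨ ℚ.fromℚᵘ-cong {mkℚᵘ (+ ℓ ℤ.* + P) (suc l)} {mkℚᵘ (+ P) 0} (*≡* (trans (ℤ.*-identityʳ _) (ℤ.*-comm (+ ℓ) (+ P)))) ⟩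
  + P / 1 ∎
  where
  open ≡-Reasoning
  ℓ = suc (suc l)
  N = crossing (suc k) ℓ
  P = admitted k ℓ
  Q = excluded k (suc l)
  P≡ : P ≡ suc l * Q
  P≡ = +-cancelʳ-≡ Q P (suc l * Q) (trans (admitted+excluded k l) (trans (crossing≡excluded k (suc l)) (+-comm Q (suc l * Q))))
  swap : ∀ a c q → a * (c * q) ≡ c * (a * q)
  swap = solve-∀
  count : suc l * N ≡ ℓ * P
  count = trans (cong (suc l *_) (crossing≡excluded k (suc l))) (trans (swap (suc l) ℓ Q) (cong (ℓ *_) (sym P≡)))

-- Pascal's rule in closed form. The cutoff L depends on G and not on m, matching `f`, whose sum
-- stops at the uniformity.
binomialSum-expand : ∀ L G m → (∀ ℓ → L ≤ ℓ → G ℓ ≡ 0) → ∑[ ℓ ← upTo L ] ((m C ℓ) * G ℓ) ≡ binomialSum G m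
binomialSum-expand zero    G zero    G≡0 = sym (G≡0 0 z≤n)
binomialSum-expand (suc L) G zero    G≡0 = begin
  ∑[ ℓ ← upTo (suc L) ] ((0 C ℓ) * G ℓ)   ≡⟨ ∑-upTo-suc L (λ ℓ → (0 C ℓ) * G ℓ) ⟩
  1 * G 0 + ∑[ ℓ ← upTo L ] 0             ≡⟨ cong₂ _+_ (*-identityˡ (G 0)) (∑-0 (upTo L)) ⟩
  G 0 + 0                                 ≡⟨ +-identityʳ (G 0) ⟩
  G 0                                     ∎
  where open ≡-Reasoning
binomialSum-expand zero    G (suc m) G≡0 = cong₂ _+_ (binomialSum-expand 0 (G ∘ suc) m (λ ℓ _ → G≡0 (suc ℓ) z≤n)) (binomialSum-expand 0 G m G≡0)
binomialSum-expand (suc L) G (suc m) G≡0 = begin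
  ∑[ ℓ ← upTo (suc L) ] ((suc m C ℓ) * G ℓ)
    ≡⟨ ∑-upTo-suc L (λ ℓ → (suc m C ℓ) * G ℓ) ⟩
  (suc m C 0) * G 0 + ∑[ ℓ ← upTo L ] ((suc m C suc ℓ) * G (suc ℓ))
    ≡⟨ cong₂ _+_ {(suc m C 0) * G 0} refl
        (trans (∑-cong (upTo L) (λ ℓ → trans (cong (_* G (suc ℓ)) (sym (nCk+nC[k+1]≡[n+1]C[k+1] m ℓ))) (*-distribʳ-+ (G (suc ℓ)) (m C ℓ) (m C suc ℓ))))
               (∑-+ (upTo L) (λ ℓ → (m C ℓ) * G (suc ℓ)) (λ ℓ → (m C suc ℓ) * G (suc ℓ)))) ⟩
  (m C 0) * G 0 + (s + ∑[ ℓ ← upTo L ] ((m C suc ℓ) * G (suc ℓ)))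
    ≡⟨ x∙yz≈y∙xz ((m C 0) * G 0) s _ ⟩
  s + ((m C 0) * G 0 + ∑[ ℓ ← upTo L ] ((m C suc ℓ) * G (suc ℓ)))
    ≡⟨ cong₂ _+_ (sym s≡) (sym (∑-upTo-suc L (λ ℓ → (m C ℓ) * G ℓ))) ⟩
  ∑[ ℓ ← upTo (suc L) ] ((m C ℓ) * G (suc ℓ)) + ∑[ ℓ ← upTo (suc L) ] ((m C ℓ) * G ℓ)
    ≡⟨ cong₂ _+_ (binomialSum-expand (suc L) (G ∘ suc) m (λ ℓ le → G≡0 (suc ℓ) (m≤n⇒m≤1+n le))) (binomialSum-expand (suc L) G m G≡0) ⟩
  binomialSum G (suc m) ∎
  where
  open ≡-Reasoning
  s = ∑[ ℓ ← upTo L ] ((m C ℓ) * G (suc ℓ))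
  -- The shifted function is summed up to the same cutoff; its extra last term is a value of G
  -- beyond the cutoff.
  s≡ : ∑[ ℓ ← upTo (suc L) ] ((m C ℓ) * G (suc ℓ)) ≡ s
  s≡ = trans (∑-upTo-last L (λ ℓ → (m C ℓ) * G (suc ℓ)))
             (trans (cong (λ g → s + (m C L) * g) (G≡0 (suc L) ≤-refl)) (trans (cong (λ y → s + y) (*-zeroʳ (m C L))) (+-identityʳ s)))

f≡binomialSum : ∀ k m → f (suc k) m ≡ fromℕ (binomialSum (admitted k) m)
f≡binomialSum k m = begin
  fromℕ m ℚ.+ sumℚ k (λ j → b (suc k) (suc (suc j)) ℚ.* fromℕ (m C suc (suc j)))
    ≡⟨ cong (fromℕ m ℚ.+_) (sumℚ-fromℕ k _ h₂ term) ⟩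
  fromℕ m ℚ.+ fromℕ (∑ (upTo k) h₂)
    ≡⟨ fromℕ-+ m (∑ (upTo k) h₂) ⟨
  fromℕ (m + ∑ (upTo k) h₂)
    ≡⟨ cong fromℕ expand-h ⟩
  fromℕ (binomialSum (admitted k) m) ∎
  where
  open ≡-Reasoning
  h : ℕ → ℕ
  h ℓ = (m C ℓ) * admitted k ℓ
  h₂ : ℕ → ℕ
  h₂ j = h (suc (suc j))
  term : ∀ j → b (suc k) (suc (suc j)) ℚ.* fromℕ (m C suc (suc j)) ≡ fromℕ (h (suc (suc j)))
  term j = begin
    b (suc k) (suc (suc j)) ℚ.* fromℕ (m C suc (suc j))  ≡⟨ cong (ℚ._* fromℕ (m C suc (suc j))) (b≡admitted k j) ⟩
    fromℕ (admitted k (suc (suc j))) ℚ.* fromℕ (m C suc (suc j)) ≡⟨ fromℕ-* (admitted k (suc (suc j))) (m C suc (suc j)) ⟨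
    fromℕ (admitted k (suc (suc j)) * (m C suc (suc j))) ≡⟨ cong fromℕ (*-comm (admitted k (suc (suc j))) (m C suc (suc j))) ⟩
    fromℕ (h (suc (suc j))) ∎
  expand-h : m + ∑ (upTo k) h₂ ≡ binomialSum (admitted k) m
  expand-h = begin
    m + ∑ (upTo k) h₂
      ≡⟨ cong (_+ ∑ (upTo k) h₂) (trans (cong₂ _*_ (nC1≡n m) (admitted-1 k)) (*-identityʳ m)) ⟨
    h 1 + ∑ (upTo k) h₂
      ≡⟨ ∑-upTo-suc k (h ∘ suc) ⟨
    ∑ (upTo (suc k)) (h ∘ suc)
      -- The term ℓ = 0 may be added since no edge has empty support.
      ≡⟨ cong (_+ ∑ (upTo (suc k)) (h ∘ suc)) (*-zeroʳ (m C 0)) ⟨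
    h 0 + ∑ (upTo (suc k)) (h ∘ suc)
      ≡⟨ ∑-upTo-suc (suc k) h ⟨
    ∑ (upTo (suc (suc k))) h
      ≡⟨ binomialSum-expand (suc (suc k)) (admitted k) m (admitted-large k) ⟩
    binomialSum (admitted k) m ∎

theorem1 : (k m : ℕ) → 2 ≤ k → 1 ≤ m →
    ((H : Hypergraph k (k * m)) → HasUniquePerfectMatching H → (+ numEdges H / 1) ≤ℚ f k m)
    × Σ (Hypergraph k (k * m)) (λ H → HasUniquePerfectMatching H × ((+ numEdges H / 1) ≡ f k m))
theorem1 (suc k) m _ _ =
  (λ H unique → subst (fromℕ (numEdges H) ≤ℚ_) (sym (f≡binomialSum k m)) (fromℕ-mono (upper-bound k m H unique))) ,
  Extremal.H k m , Extremal.uniqueMatching k m , trans (cong fromℕ (Extremal.numEdges≡ k m)) (sym (f≡binomialSum k m))
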